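{- Let $\gamma^-$ be the largest value such that for all $\gamma\in(0,\gamma^-)$ and for each geometric instance with ratio $\gamma$ there is an optimal 2WCST whose root is an equal-to test. Then $$\gamma^-=\frac{\sqrt5-1}{2}.$$
   Context: An instance is a linearly ordered set $\mathcal K$ of keys, each key $k$ having a weight $w_k\ge 0$. A two-way comparison search tree (2WCST) for $\mathcal K$ is a rooted binary decision tree whose leaves are in bijection with the keys of $\mathcal K$ and in which each internal node is labelled either with an equal-to test $\langle =k\rangle$ ("is $q=k$?") or a less-than test $\langle <k\rangle$ ("is $q<k$?") for a key $k\in\mathcal K$, and has two children, one for the answer "yes" and one for the answer "no". It is required that for each query $q\in\mathcal K$, the search starting at the root ends (after finitely many steps) in the leaf labelled $q$. The cost of $T$ is $\sum_{k}w_k\cdot \mathrm{depth}(k)$, where $\mathrm{depth}(k)$ is the number of comparison nodes on the path from the root to leaf $k$; $T$ is optimal if its cost is minimum among all 2WCSTs for the instance. For $0<\gamma<1$, a geometric instance with ratio $\gamma$ is an instance with a countably infinite key set whose key weights are the terms of the infinite geometric sequence $(\gamma^i)_{i\ge 0}$, each weight $\gamma^i$ being the weight of exactly one key; the linear order of the keys is arbitrary (it need not be related to the weights). Trees for such instances are infinite, with every leaf at finite depth. -}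

module Defs where

open import Data.Bool.Base using (Bool; true; false)
open import Data.Integer.Base as ℤ using (+_)
import Data.Integer.Properties as ℤ
open import Data.List.Base using (List; []; _∷_; length; foldr)
open import Data.List.Relation.Unary.Unique.Propositional using (Unique)
open import Data.Nat.Base as ℕ using (ℕ; zero; suc)
import Data.Nat.Properties as ℕ
open import Data.Nat.Tactic.RingSolver using () renaming (solve-∀ to ℕ-solve-∀)
open import Data.Product.Base using (∃-syntax; _×_; _,_; proj₁; proj₂)
open import Data.Product using (∃!)
open import Data.Rational.Base as ℚ using (ℚ; 0ℚ; 1ℚ; ½; ∣_∣; toℚᵘ)
import Data.Rational.Properties as ℚ
open import Data.Rational.Solver using (module +-*-Solver)
open import Data.Rational.Unnormalised.Base as ℚᵘ using (mkℚᵘ; *≡*; *<*; *≤*)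
import Data.Rational.Unnormalised.Properties as ℚᵘ
open import Data.Sum.Base using (inj₁; inj₂)
open import Function.Bundles using (_↔_; module Inverse)
open import Relation.Binary.Core using (Rel)
open import Relation.Binary.PropositionalEquality
  using (_≡_; refl; sym; trans; cong; cong₂; subst; subst₂)
open import Relation.Binary.Structures using (IsStrictTotalOrder)
open import Relation.Nullary.Decidable.Core using (does; yes; no)
open import Level using (0ℓ)

Eventually : (ℕ → Set) → Set
Eventually P = ∃[ N ] ∀ n → N ℕ.≤ n → P n

Cauchy : (ℕ → ℚ) → Set
Cauchy x = ∀ ε → 0ℚ ℚ.< ε →
  ∃[ N ] ∀ m n → N ℕ.≤ m → N ℕ.≤ n → ∣ x m ℚ.- x n ∣ ℚ.< ε

-- The reals are rational Cauchy sequences up to _≈_.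
record ℝ : Set where
  constructor mkℝ
  field
    seq    : ℕ → ℚ
    cauchy : Cauchy seq

open ℝ public

infix 4 _<_ _≤_ _≈_

_<_ : Rel ℝ 0ℓ
x < y = ∃[ ε ] 0ℚ ℚ.< ε × Eventually λ n → seq x n ℚ.+ ε ℚ.≤ seq y n

_≤_ : Rel ℝ 0ℓ
x ≤ y = ∀ ε → 0ℚ ℚ.< ε → Eventually λ n → seq x n ℚ.≤ seq y n ℚ.+ ε

_≈_ : Rel ℝ 0ℓ
x ≈ y = x ≤ y × y ≤ x

∣p-p∣≡0 : ∀ p → ∣ p ℚ.- p ∣ ≡ 0ℚ
∣p-p∣≡0 p = cong ∣_∣ (ℚ.+-inverseʳ p)

p*½+p*½≡p : ∀ p → p ℚ.* ½ ℚ.+ p ℚ.* ½ ≡ p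
p*½+p*½≡p p = trans (sym (ℚ.*-distribˡ-+ p ½ ½)) (ℚ.*-identityʳ p)

0<p*q : ∀ {p q} → 0ℚ ℚ.< p → 0ℚ ℚ.< q → 0ℚ ℚ.< p ℚ.* q
0<p*q {p} {q} 0<p 0<q =
  ℚ.positive⁻¹ _ {{ℚ.pos*pos⇒pos p {{ℚ.positive 0<p}} q {{ℚ.positive 0<q}}}}

0<½ : 0ℚ ℚ.< ½
0<½ = ℚ.positive⁻¹ ½

fromℚ : ℚ → ℝ
fromℚ p = mkℝ (λ _ → p) λ ε 0<ε →
  0 , λ _ _ _ _ → subst (ℚ._< ε) (sym (∣p-p∣≡0 p)) 0<ε

fromℕ : ℕ → ℝ
fromℕ n = fromℚ (+ n ℚ./ 1)

0ℝ 1ℝ ½ℝ : ℝ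
0ℝ = fromℚ 0ℚ
1ℝ = fromℚ 1ℚ
½ℝ = fromℚ ½

+-cauchy : ∀ {x y} → Cauchy x → Cauchy y → Cauchy (λ n → x n ℚ.+ y n)
+-cauchy {x} {y} cx cy ε 0<ε
  with M , hx ← cx (ε ℚ.* ½) (0<p*q 0<ε 0<½)
     | N , hy ← cy (ε ℚ.* ½) (0<p*q 0<ε 0<½)
  = M ℕ.⊔ N , λ m n p q → begin-strict
    ∣ (x m ℚ.+ y m) ℚ.- (x n ℚ.+ y n) ∣          ≡⟨ cong ∣_∣ (regroup (x m) (y m) (x n) (y n)) ⟩
    ∣ (x m ℚ.- x n) ℚ.+ (y m ℚ.- y n) ∣          ≤⟨ ℚ.∣p+q∣≤∣p∣+∣q∣ (x m ℚ.- x n) (y m ℚ.- y n) ⟩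
    ∣ x m ℚ.- x n ∣ ℚ.+ ∣ y m ℚ.- y n ∣          <⟨ ℚ.+-mono-< (hx m n (ℕ.m⊔n≤o⇒m≤o M N p) (ℕ.m⊔n≤o⇒m≤o M N q))
                                                           (hy m n (ℕ.m⊔n≤o⇒n≤o M N p) (ℕ.m⊔n≤o⇒n≤o M N q)) ⟩
    ε ℚ.* ½ ℚ.+ ε ℚ.* ½                          ≡⟨ p*½+p*½≡p ε ⟩
    ε                                            ∎
  where
  open ℚ.≤-Reasoning
  regroup : ∀ a b c d → (a ℚ.+ b) ℚ.- (c ℚ.+ d) ≡ (a ℚ.- c) ℚ.+ (b ℚ.- d)
  regroup = solve 4 (λ a b c d → (a :+ b) :- (c :+ d) := (a :- c) :+ (b :- d)) refl
    where open +-*-Solver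

neg-cauchy : ∀ {x} → Cauchy x → Cauchy (λ n → ℚ.- x n)
neg-cauchy {x} cx ε 0<ε with N , hx ← cx ε 0<ε
  = N , λ m n p q → subst (ℚ._< ε) (eq (x m) (x n)) (hx m n p q)
  where
  open +-*-Solver
  eq : ∀ a b → ∣ a ℚ.- b ∣ ≡ ∣ ℚ.- a ℚ.- (ℚ.- b) ∣
  eq a b = trans (sym (ℚ.∣-p∣≡∣p∣ (a ℚ.- b)))
    (cong ∣_∣ (solve 2 (λ a b → :- (a :- b) := :- a :- (:- b)) refl a b))

eventually-bounded : ∀ {x} → Cauchy x →
  ∃[ B ] 0ℚ ℚ.< B × Eventually λ n → ∣ x n ∣ ℚ.≤ B
eventually-bounded {x} cx with N , hx ← cx 1ℚ (ℚ.positive⁻¹ 1ℚ)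
  = 1ℚ ℚ.+ ∣ x N ∣
  , ℚ.+-mono-<-≤ (ℚ.positive⁻¹ 1ℚ) (ℚ.0≤∣p∣ (x N))
  , N , λ n N≤n → begin
    ∣ x n ∣                            ≡⟨ cong ∣_∣ (split (x n) (x N)) ⟩
    ∣ (x n ℚ.- x N) ℚ.+ x N ∣          ≤⟨ ℚ.∣p+q∣≤∣p∣+∣q∣ (x n ℚ.- x N) (x N) ⟩
    ∣ x n ℚ.- x N ∣ ℚ.+ ∣ x N ∣        ≤⟨ ℚ.+-monoˡ-≤ ∣ x N ∣ (ℚ.<⇒≤ (hx n N N≤n ℕ.≤-refl)) ⟩
    1ℚ ℚ.+ ∣ x N ∣                     ∎
  where
  open ℚ.≤-Reasoning
  split : ∀ a b → a ≡ (a ℚ.- b) ℚ.+ b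
  split = solve 2 (λ a b → a := (a :- b) :+ b) refl
    where open +-*-Solver

*-small : ∀ B ε → 0ℚ ℚ.< B → 0ℚ ℚ.< ε → ∃[ δ ] 0ℚ ℚ.< δ ×
  (∀ b d → ∣ b ∣ ℚ.≤ B → ∣ d ∣ ℚ.< δ → ∣ b ℚ.* d ∣ ℚ.< ε)
*-small B ε 0<B 0<ε = ε ℚ.* ℚ.1/ B
  , 0<p*q 0<ε (ℚ.positive⁻¹ (ℚ.1/ B) {{ℚ.1/pos⇒pos B}})
  , λ b d b≤B d<ε/B → begin-strict
  ∣ b ℚ.* d ∣               ≡⟨ ℚ.∣p*q∣≡∣p∣*∣q∣ b d ⟩
  ∣ b ∣ ℚ.* ∣ d ∣           ≤⟨ ℚ.*-monoʳ-≤-nonNeg ∣ d ∣ {{ℚ.nonNegative (ℚ.0≤∣p∣ d)}} b≤B ⟩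
  B ℚ.* ∣ d ∣               <⟨ ℚ.*-monoʳ-<-pos B d<ε/B ⟩
  B ℚ.* (ε ℚ.* ℚ.1/ B)      ≡⟨ cong (B ℚ.*_) (ℚ.*-comm ε (ℚ.1/ B)) ⟩
  B ℚ.* (ℚ.1/ B ℚ.* ε)      ≡⟨ sym (ℚ.*-assoc B (ℚ.1/ B) ε) ⟩
  B ℚ.* ℚ.1/ B ℚ.* ε        ≡⟨ cong (ℚ._* ε) (ℚ.*-inverseʳ B) ⟩
  1ℚ ℚ.* ε                  ≡⟨ ℚ.*-identityˡ ε ⟩
  ε                         ∎
  where
  open ℚ.≤-Reasoning
  instance
    _ = ℚ.positive 0<B
    _ = ℚ.pos⇒nonZero B

*-close : ∀ a b c d ε →
  ∣ d ℚ.* (a ℚ.- c) ∣ ℚ.< ε ℚ.* ½ → ∣ a ℚ.* (b ℚ.- d) ∣ ℚ.< ε ℚ.* ½ →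
  ∣ a ℚ.* b ℚ.- c ℚ.* d ∣ ℚ.< ε
*-close a b c d ε h₁ h₂ = begin-strict
  ∣ a ℚ.* b ℚ.- c ℚ.* d ∣                        ≡⟨ cong ∣_∣ (regroup a b c d) ⟩
  ∣ d ℚ.* (a ℚ.- c) ℚ.+ a ℚ.* (b ℚ.- d) ∣        ≤⟨ ℚ.∣p+q∣≤∣p∣+∣q∣ (d ℚ.* (a ℚ.- c)) (a ℚ.* (b ℚ.- d)) ⟩
  ∣ d ℚ.* (a ℚ.- c) ∣ ℚ.+ ∣ a ℚ.* (b ℚ.- d) ∣    <⟨ ℚ.+-mono-< h₁ h₂ ⟩
  ε ℚ.* ½ ℚ.+ ε ℚ.* ½                            ≡⟨ p*½+p*½≡p ε ⟩
  ε                                              ∎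
  where
  open ℚ.≤-Reasoning
  regroup : ∀ a b c d → a ℚ.* b ℚ.- c ℚ.* d ≡ d ℚ.* (a ℚ.- c) ℚ.+ a ℚ.* (b ℚ.- d)
  regroup = solve 4 (λ a b c d → a :* b :- c :* d := d :* (a :- c) :+ a :* (b :- d)) refl
    where open +-*-Solver

*-cauchy : ∀ {x y} → Cauchy x → Cauchy y → Cauchy (λ n → x n ℚ.* y n)
*-cauchy {x} {y} cx cy ε 0<ε =
  let 0<ε/2            = 0<p*q 0<ε 0<½
      A , 0<A , K , hA = eventually-bounded cx
      B , 0<B , L , hB = eventually-bounded cy
      α , 0<α , sα     = *-small A (ε ℚ.* ½) 0<A 0<ε/2
      β , 0<β , sβ     = *-small B (ε ℚ.* ½) 0<B 0<ε/2
      M , hx           = cx β 0<β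
      N , hy           = cy α 0<α
      K≤ : ∀ {n} → (K ℕ.⊔ L) ℕ.⊔ (M ℕ.⊔ N) ℕ.≤ n → K ℕ.≤ n
      K≤ p = ℕ.m⊔n≤o⇒m≤o K L (ℕ.m⊔n≤o⇒m≤o (K ℕ.⊔ L) (M ℕ.⊔ N) p)
      L≤ : ∀ {n} → (K ℕ.⊔ L) ℕ.⊔ (M ℕ.⊔ N) ℕ.≤ n → L ℕ.≤ n
      L≤ p = ℕ.m⊔n≤o⇒n≤o K L (ℕ.m⊔n≤o⇒m≤o (K ℕ.⊔ L) (M ℕ.⊔ N) p)
      M≤ : ∀ {n} → (K ℕ.⊔ L) ℕ.⊔ (M ℕ.⊔ N) ℕ.≤ n → M ℕ.≤ n
      M≤ p = ℕ.m⊔n≤o⇒m≤o M N (ℕ.m⊔n≤o⇒n≤o (K ℕ.⊔ L) (M ℕ.⊔ N) p)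
      N≤ : ∀ {n} → (K ℕ.⊔ L) ℕ.⊔ (M ℕ.⊔ N) ℕ.≤ n → N ℕ.≤ n
      N≤ p = ℕ.m⊔n≤o⇒n≤o M N (ℕ.m⊔n≤o⇒n≤o (K ℕ.⊔ L) (M ℕ.⊔ N) p)
  in (K ℕ.⊔ L) ℕ.⊔ (M ℕ.⊔ N) , λ m n p q →
    *-close (x m) (y m) (x n) (y n) ε
      (sβ (y n) (x m ℚ.- x n) (hB n (L≤ q)) (hx m n (M≤ p) (M≤ q)))
      (sα (x m) (y m ℚ.- y n) (hA m (K≤ p)) (hy m n (N≤ p) (N≤ q)))

infix  8 -_
infixl 7 _*_
infixl 6 _+_ _-_
infixr 8 _^_

_+_ : ℝ → ℝ → ℝ
x + y = mkℝ (λ n → seq x n ℚ.+ seq y n) (+-cauchy {seq x} {seq y} (cauchy x) (cauchy y))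

-_ : ℝ → ℝ
- x = mkℝ (λ n → ℚ.- seq x n) (neg-cauchy {seq x} (cauchy x))

_-_ : ℝ → ℝ → ℝ
x - y = x + (- y)

_*_ : ℝ → ℝ → ℝ
x * y = mkℝ (λ n → seq x n ℚ.* seq y n) (*-cauchy {seq x} {seq y} (cauchy x) (cauchy y))

_^_ : ℝ → ℕ → ℝ
x ^ zero  = 1ℝ
x ^ suc n = x * x ^ n

√-next : ℕ → ℕ → ℕ
√-next r n with suc r ℕ.* suc r ℕ.≤? n
... | yes _ = suc r
... | no  _ = r

⌊√_⌋ : ℕ → ℕ
⌊√ zero ⌋  = zero
⌊√ suc n ⌋ = √-next ⌊√ n ⌋ (suc n)

⌊√⌋²≤ : ∀ n → ⌊√ n ⌋ ℕ.* ⌊√ n ⌋ ℕ.≤ n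
⌊√⌋²≤ zero = ℕ.z≤n
⌊√⌋²≤ (suc n) with suc ⌊√ n ⌋ ℕ.* suc ⌊√ n ⌋ ℕ.≤? suc n
... | yes p = p
... | no  _ = ℕ.m≤n⇒m≤1+n (⌊√⌋²≤ n)

<⌊√⌋+1² : ∀ n → n ℕ.< suc ⌊√ n ⌋ ℕ.* suc ⌊√ n ⌋
<⌊√⌋+1² zero = ℕ.s≤s ℕ.z≤n
<⌊√⌋+1² (suc n) with suc ⌊√ n ⌋ ℕ.* suc ⌊√ n ⌋ ℕ.≤? suc n
... | yes _ = ℕ.≤-<-trans (<⌊√⌋+1² n) (ℕ.*-mono-< (ℕ.n<1+n (suc ⌊√ n ⌋)) (ℕ.n<1+n (suc ⌊√ n ⌋)))
... | no ¬p = ℕ.≰⇒> ¬p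

-- √ k is the limit of ⌊(n+1)√k⌋ / (n+1).
√-seq : ℕ → ℕ → ℚ
√-seq k n = + ⌊√ k ℕ.* (suc n ℕ.* suc n) ⌋ ℚ./ suc n

√-cross : ∀ k m n →
  ⌊√ k ℕ.* (suc m ℕ.* suc m) ⌋ ℕ.* suc n ℕ.< suc ⌊√ k ℕ.* (suc n ℕ.* suc n) ⌋ ℕ.* suc m
√-cross k m n = ℕ.≰⇒> λ ba≤ab → ℕ.<-irrefl refl (begin-strict
  (b ℕ.* suc m) ℕ.* (b ℕ.* suc m)               ≤⟨ ℕ.*-mono-≤ ba≤ab ba≤ab ⟩
  (a ℕ.* suc n) ℕ.* (a ℕ.* suc n)               ≡⟨ swap a (suc n) ⟩
  (a ℕ.* a) ℕ.* (suc n ℕ.* suc n)               ≤⟨ ℕ.*-monoˡ-≤ (suc n ℕ.* suc n) (⌊√⌋²≤ (k ℕ.* (suc m ℕ.* suc m))) ⟩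
  k ℕ.* (suc m ℕ.* suc m) ℕ.* (suc n ℕ.* suc n) ≡⟨ swap′ k (suc m ℕ.* suc m) (suc n ℕ.* suc n) ⟩
  k ℕ.* (suc n ℕ.* suc n) ℕ.* (suc m ℕ.* suc m) <⟨ ℕ.*-monoˡ-< (suc m ℕ.* suc m) (<⌊√⌋+1² (k ℕ.* (suc n ℕ.* suc n))) ⟩
  (b ℕ.* b) ℕ.* (suc m ℕ.* suc m)               ≡⟨ sym (swap b (suc m)) ⟩
  (b ℕ.* suc m) ℕ.* (b ℕ.* suc m)               ∎)
  where
  open ℕ.≤-Reasoning
  a = ⌊√ k ℕ.* (suc m ℕ.* suc m) ⌋
  b = suc ⌊√ k ℕ.* (suc n ℕ.* suc n) ⌋
  swap : ∀ p q → (p ℕ.* q) ℕ.* (p ℕ.* q) ≡ (p ℕ.* p) ℕ.* (q ℕ.* q)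
  swap = ℕ-solve-∀
  swap′ : ∀ p q r → p ℕ.* q ℕ.* r ≡ p ℕ.* r ℕ.* q
  swap′ = ℕ-solve-∀

/-mono-< : ∀ a m b n → a ℕ.* suc n ℕ.< b ℕ.* suc m → + a ℚ./ suc m ℚ.< + b ℚ./ suc n
/-mono-< a m b n h = ℚ.toℚᵘ-cancel-<
  (ℚᵘ.<-respˡ-≃ (ℚᵘ.≃-sym (ℚ.toℚᵘ-fromℚᵘ (mkℚᵘ (+ a) m)))
  (ℚᵘ.<-respʳ-≃ (ℚᵘ.≃-sym (ℚ.toℚᵘ-fromℚᵘ (mkℚᵘ (+ b) n)))
  (*<* (subst₂ ℤ._<_ (ℤ.pos-* a (suc n)) (ℤ.pos-* b (suc m)) (ℤ.+<+ h)))))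

/-mono-≤ : ∀ a m b n → a ℕ.* suc n ℕ.≤ b ℕ.* suc m → + a ℚ./ suc m ℚ.≤ + b ℚ./ suc n
/-mono-≤ a m b n h = ℚ.toℚᵘ-cancel-≤
  (ℚᵘ.≤-respˡ-≃ (ℚᵘ.≃-sym (ℚ.toℚᵘ-fromℚᵘ (mkℚᵘ (+ a) m)))
  (ℚᵘ.≤-respʳ-≃ (ℚᵘ.≃-sym (ℚ.toℚᵘ-fromℚᵘ (mkℚᵘ (+ b) n)))
  (*≤* (subst₂ ℤ._≤_ (ℤ.pos-* a (suc n)) (ℤ.pos-* b (suc m)) (ℤ.+≤+ h)))))

suc-/ : ∀ a n → + suc a ℚ./ suc n ≡ + a ℚ./ suc n ℚ.+ + 1 ℚ./ suc n
suc-/ a n = ℚ.toℚᵘ-injective (begin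
  toℚᵘ (+ suc a ℚ./ suc n)                                ≈⟨ ℚ.toℚᵘ-fromℚᵘ (mkℚᵘ (+ suc a) n) ⟩
  mkℚᵘ (+ suc a) n                                        ≈⟨ *≡* cross ⟩
  mkℚᵘ (+ (a ℕ.* suc n ℕ.+ 1 ℕ.* suc n)) (n ℕ.+ n ℕ.* suc n) ≡⟨ cong (λ i → mkℚᵘ i (n ℕ.+ n ℕ.* suc n)) (cong₂ ℤ._+_ (ℤ.pos-* a (suc n)) (ℤ.pos-* 1 (suc n))) ⟩
  mkℚᵘ (+ a) n ℚᵘ.+ mkℚᵘ (+ 1) n                          ≈⟨ ℚᵘ.+-cong (ℚᵘ.≃-sym (ℚ.toℚᵘ-fromℚᵘ (mkℚᵘ (+ a) n))) (ℚᵘ.≃-sym (ℚ.toℚᵘ-fromℚᵘ (mkℚᵘ (+ 1) n))) ⟩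
  toℚᵘ (+ a ℚ./ suc n) ℚᵘ.+ toℚᵘ (+ 1 ℚ./ suc n)          ≈⟨ ℚᵘ.≃-sym (ℚ.toℚᵘ-homo-+ (+ a ℚ./ suc n) (+ 1 ℚ./ suc n)) ⟩
  toℚᵘ (+ a ℚ./ suc n ℚ.+ + 1 ℚ./ suc n)                  ∎)
  where
  open ℚᵘ.≃-Reasoning
  eq : ∀ a s → suc a ℕ.* (s ℕ.* s) ≡ (a ℕ.* s ℕ.+ 1 ℕ.* s) ℕ.* s
  eq = ℕ-solve-∀
  cross : + suc a ℤ.* + (suc n ℕ.* suc n) ≡ + (a ℕ.* suc n ℕ.+ 1 ℕ.* suc n) ℤ.* + suc n
  cross = trans (sym (ℤ.pos-* (suc a) (suc n ℕ.* suc n)))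
    (trans (cong +_ (eq a (suc n))) (ℤ.pos-* (a ℕ.* suc n ℕ.+ 1 ℕ.* suc n) (suc n)))

√-step : ∀ k m n → √-seq k m ℚ.- √-seq k n ℚ.< + 1 ℚ./ suc n
√-step k m n = subst (√-seq k m ℚ.- √-seq k n ℚ.<_) (cancel (√-seq k n) (+ 1 ℚ./ suc n))
  (ℚ.+-monoˡ-< (ℚ.- √-seq k n) {√-seq k m} {√-seq k n ℚ.+ + 1 ℚ./ suc n}
    (subst (√-seq k m ℚ.<_) (suc-/ ⌊√ k ℕ.* (suc n ℕ.* suc n) ⌋ n)
      (/-mono-< ⌊√ k ℕ.* (suc m ℕ.* suc m) ⌋ m (suc ⌊√ k ℕ.* (suc n ℕ.* suc n) ⌋) n (√-cross k m n))))
  where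
  cancel : ∀ p q → (p ℚ.+ q) ℚ.- p ≡ q
  cancel = solve 2 (λ p q → (p :+ q) :- p := q) refl
    where open +-*-Solver

1/N≤ε : ∀ ε → 0ℚ ℚ.< ε → ∃[ N ] ∀ n → N ℕ.≤ n → + 1 ℚ./ suc n ℚ.≤ ε
1/N≤ε (ℚ.mkℚ (+ zero)  d c) (ℚ.*<* (ℤ.+<+ ()))
1/N≤ε (ℚ.mkℚ ℤ.-[1+ _ ] d c) (ℚ.*<* ())
1/N≤ε ε@(ℚ.mkℚ (+ suc a) d c) _ = d , λ n d≤n →
  subst (+ 1 ℚ./ suc n ℚ.≤_) (ℚ.fromℚᵘ-toℚᵘ ε)
    (/-mono-≤ 1 n (suc a) d (ℕ.*-mono-≤ (ℕ.s≤s (ℕ.z≤n {a})) (ℕ.s≤s d≤n)))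

∣p∣<q : ∀ {p q} → p ℚ.< q → ℚ.- p ℚ.< q → ∣ p ∣ ℚ.< q
∣p∣<q {p} {q} p<q -p<q with ℚ.∣p∣≡p∨∣p∣≡-p p
... | inj₁ e = subst (ℚ._< q) (sym e) p<q
... | inj₂ e = subst (ℚ._< q) (sym e) -p<q

√-cauchy : ∀ k → Cauchy (√-seq k)
√-cauchy k ε 0<ε with N , h ← 1/N≤ε ε 0<ε
  = N , λ m n p q → ∣p∣<q
    (ℚ.<-≤-trans (√-step k m n) (h n q))
    (subst (ℚ._< ε) (flip (√-seq k n) (√-seq k m))
      (ℚ.<-≤-trans (√-step k n m) (h m p)))
  where
  flip : ∀ p q → p ℚ.- q ≡ ℚ.- (q ℚ.- p)
  flip = solve 2 (λ p q → p :- q := :- (q :- p)) refl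
    where open +-*-Solver

infix 9 √_

√_ : ℕ → ℝ
√ k = mkℝ (√-seq k) (√-cauchy k)

IsGreatest : ∀ {ℓ} → (ℝ → Set ℓ) → ℝ → Set ℓ
IsGreatest S m = S m × (∀ x → S x → x ≤ m)

record Instance : Set₁ where
  infix 4 _≺_
  field
    Key                : Set
    _≺_                : Rel Key 0ℓ
    isStrictTotalOrder : IsStrictTotalOrder _≡_ _≺_
    weight             : Key → ℝ
    weight≥0           : ∀ k → 0ℝ ≤ weight k

  open IsStrictTotalOrder isStrictTotalOrder public
    using () renaming (_≟_ to _≟ᴷ_; _<?_ to _≺?_)

-- The linear order on the keys is unconstrained.
record IsGeometric (γ : ℝ) (I : Instance) : Set where
  open Instance I
  field
    0<γ    : 0ℝ < γ
    γ<1    : γ < 1ℝ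
    index  : ℕ ↔ Key
    weight-index : ∀ i → weight (Inverse.to index i) ≈ γ ^ i

data Test (K : Set) : Set where
  ⟨=_⟩ ⟨<_⟩ : K → Test K

data Node (K : Set) : Set where
  leaf : K → Node K
  test : Test K → Node K

-- A path from the root; true is the branch for the answer "yes".
Address : Set
Address = List Bool

-- Trees may be infinite, so a binary tree is given by the node found at each
-- address.  Labels at addresses strictly below a leaf are not part of the tree.
Tree : Set → Set
Tree K = Address → Node K

child : ∀ {K} → Tree K → Bool → Tree K
child t b a = t (b ∷ a)

data LeafAt {K : Set} (t : Tree K) : Address → K → Set where
  here  : ∀ {k} → t [] ≡ leaf k → LeafAt t [] k
  there : ∀ {τ b a k} → t [] ≡ test τ → LeafAt (child t b) a k → LeafAt t (b ∷ a) k

module _ (I : Instance) where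
  open Instance I

  answer : Key → Test Key → Bool
  answer q ⟨= k ⟩ = does (q ≟ᴷ k)
  answer q ⟨< k ⟩ = does (q ≺? k)

  -- The search for q in t stops, after finitely many steps, in a leaf labelled k.
  data SearchEndsIn (q : Key) (t : Tree Key) (k : Key) : Set where
    stop : t [] ≡ leaf k → SearchEndsIn q t k
    step : ∀ {τ} → t [] ≡ test τ →
           SearchEndsIn q (child t (answer q τ)) k → SearchEndsIn q t k

  -- A branch that no key's search enters may be infinite without any leaf.
  record 2WCST : Set where
    field
      tree     : Tree Key
      leaf-of  : ∀ k → ∃! _≡_ λ a → LeafAt tree a k
      searches : ∀ q → SearchEndsIn q tree q

module _ {I : Instance} where
  open Instance I
  open 2WCST

  depth : 2WCST I → Key → ℕ
  depth T k = length (proj₁ (leaf-of T k))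

  RootIsEqualToTest : 2WCST I → Set
  RootIsEqualToTest T = ∃[ k ] tree T [] ≡ test ⟨= k ⟩

  partialCost : 2WCST I → List Key → ℝ
  partialCost T = foldr (λ k s → weight k * fromℕ (depth T k) + s) 0ℝ

  -- Σₖ wₖ·depth(k) ∈ [0,∞] is the supremum of its finite partial sums.
  -- CostAtMost T c says that this value is at most the real number c.
  CostAtMost : 2WCST I → ℝ → Set
  CostAtMost T c = ∀ ks → Unique ks → partialCost T ks ≤ c

  -- An element of [0,∞] is determined by its real upper bounds (∞ has none):
  -- cost T ≤ cost T′ iff every real bound on cost T′ bounds cost T.
  _≤ᶜ_ : 2WCST I → 2WCST I → Set
  T ≤ᶜ T′ = ∀ c → CostAtMost T′ c → CostAtMost T c

  IsOptimal : 2WCST I → Set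
  IsOptimal T = ∀ T′ → T ≤ᶜ T′

-- The property of g that γ⁻ is the largest value to satisfy.  Ratios γ ≥ 1 impose
-- nothing, since IsGeometric includes γ < 1.
EqualToRootsBelow : ℝ → Set₁
EqualToRootsBelow g = ∀ γ → 0ℝ < γ → γ < g →
  ∀ I → IsGeometric γ I → ∃[ T ] IsOptimal {I} T × RootIsEqualToTest T

{-# OPTIONS --safe #-}
module Submission where

-- Below the golden ratio, γ + γ² ≤ 1.  The leaf addresses of a tree form a prefix-free code, and
-- for geometric weights with such a ratio the unary code (depths 1, 2, 3, …) is optimal on every
-- set of keys: a weight dominates the sum of all weights at least two places behind it, so no root
-- that separates a set of keys in two beats splitting off the heaviest key.  Hence testing the keys
-- one by one, by decreasing weight, is optimal, whatever their order.
--
-- Above it, take the keys ordered by decreasing weight.  Separating the two heaviest keys from the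
-- others by one less-than test beats the unary cost L by some e > 0.  From an optimal tree with
-- root ⟨= k ⟩, removing k and closing the gap in the order yields a tree for the same instance.  If
-- the former costs at most L - e, the latter costs at most L - e / γ, hence so does the former.
-- Iterating, its cost would be negative.

open import Data.Bool.Base using (Bool; true; false; if_then_else_)
open import Data.Bool.ListAction using (or)
import Data.Bool.Properties as Bool
open import Data.Empty using (⊥-elim)
open import Data.Integer.Base using (+_)
import Data.Integer.Properties as ℤ
open import Data.List.Base using (List; []; _∷_; _++_; length; applyUpTo; foldr; map)
import Data.List.Properties as List
open import Data.List.Membership.Propositional using (_∈_)
open import Data.List.Membership.Propositional.Properties using (∈-∃++; ∈-applyUpTo⁺; ∈-applyUpTo⁻)
open import Data.List.Relation.Binary.Subset.Propositional using (_⊆_)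
open import Data.List.Relation.Unary.All as All using ()
open import Data.List.Relation.Unary.AllPairs using ([]; _∷_)
open import Data.List.Relation.Unary.Any using (here; there)
open import Data.List.Relation.Unary.Unique.Propositional using (Unique)
import Data.List.Relation.Unary.Unique.Propositional.Properties as Unique
open import Data.Maybe.Base using (Maybe; just; nothing; is-just)
import Data.Maybe.Properties as Maybe
open import Data.Nat.Base as ℕ using (ℕ; zero; suc; z≤n; s≤s)
import Data.Nat.Properties as ℕ
open import Data.Product.Base using (∃-syntax; _×_; _,_; proj₁; proj₂)
open import Data.Product using (∃!)
open import Data.Rational.Base as ℚ using (ℚ; 0ℚ; 1ℚ; ½)
import Data.Rational.Properties as ℚ
open import Data.Rational.Unnormalised.Base as ℚᵘ using (mkℚᵘ; *≡*)
import Data.Rational.Unnormalised.Properties as ℚᵘ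
open import Data.Sum.Base as Sum using (_⊎_; inj₁; inj₂)
open import Function.Base using (_∘_; id)
open import Function.Bundles using (_↔_; _⇔_; mk⇔; module Inverse; module Equivalence)
open import Function.Construct.Identity using (↔-id)
open import Level using (0ℓ)
open import Relation.Binary.PropositionalEquality
open import Relation.Nullary using (yes; no; ¬_; contradiction)
open import Relation.Nullary.Decidable using (does; does-⇔; dec-true; dec-false; dec⇒maybe)
open import Tactic.RingSolver using (solve-∀)
open import Tactic.RingSolver.Core.AlmostCommutativeRing using (AlmostCommutativeRing; fromCommutativeRing)
open import Defs

ℚ-ring : AlmostCommutativeRing 0ℓ 0ℓ
ℚ-ring = fromCommutativeRing ℚ.+-*-commutativeRing λ p → dec⇒maybe (0ℚ ℚ.≟ p)

-- Rational numbers

module RationalOrder where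
  private variable p q r : ℚ

  p≤q⇒0≤q-p : p ℚ.≤ q → 0ℚ ℚ.≤ q ℚ.- p
  p≤q⇒0≤q-p {p} {q} p≤q = subst (ℚ._≤ q ℚ.- p) (ℚ.+-inverseʳ p) (ℚ.+-monoˡ-≤ (ℚ.- p) p≤q)

  -- Form of most inequalities below: the difference of the two sides equals, by a ring identity
  -- `cert` or `eq`, an expression `r` built from known nonnegative quantities.
  ≤-by : 0ℚ ℚ.≤ r → q ℚ.- p ≡ r → p ℚ.≤ q
  ≤-by {r} {q} {p} 0≤r q-p≡r = subst₂ ℚ._≤_ (ℚ.+-identityˡ p) (cancel q p)
    (ℚ.+-monoˡ-≤ p (subst (0ℚ ℚ.≤_) (sym q-p≡r) 0≤r))
    where
    cancel : ∀ q p → (q ℚ.- p) ℚ.+ p ≡ q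
    cancel = solve-∀ ℚ-ring

  p<q⇒0<q-p : p ℚ.< q → 0ℚ ℚ.< q ℚ.- p
  p<q⇒0<q-p {p} {q} p<q = subst (ℚ._< q ℚ.- p) (ℚ.+-inverseʳ p) (ℚ.+-monoˡ-< (ℚ.- p) p<q)

  <-by : 0ℚ ℚ.< r → q ℚ.- p ≡ r → p ℚ.< q
  <-by {r} {q} {p} 0<r q-p≡r = subst₂ ℚ._<_ (ℚ.+-identityˡ p) (cancel q p)
    (ℚ.+-monoˡ-< p (subst (0ℚ ℚ.<_) (sym q-p≡r) 0<r))
    where
    cancel : ∀ q p → (q ℚ.- p) ℚ.+ p ≡ q
    cancel = solve-∀ ℚ-ring

  infixl 6 _⊕_
  infixl 7 _⊗_

  -- `_⊕_` and `_⊗_` act on proofs and mirror the shape of the right-hand side of the certificate.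
  _⊕_ : 0ℚ ℚ.≤ p → 0ℚ ℚ.≤ q → 0ℚ ℚ.≤ p ℚ.+ q
  _⊕_ {p} {q} 0≤p 0≤q = subst (ℚ._≤ p ℚ.+ q) (ℚ.+-identityˡ 0ℚ) (ℚ.+-mono-≤ 0≤p 0≤q)

  _⊗_ : 0ℚ ℚ.≤ p → 0ℚ ℚ.≤ q → 0ℚ ℚ.≤ p ℚ.* q
  _⊗_ {p} {q} 0≤p 0≤q = ℚ.nonNegative⁻¹ _
    {{ℚ.nonNeg*nonNeg⇒nonNeg p {{ℚ.nonNegative 0≤p}} q {{ℚ.nonNegative 0≤q}}}}

  0≤1 : 0ℚ ℚ.≤ 1ℚ
  0≤1 = ℚ.nonNegative⁻¹ 1ℚ

  cast : ℕ → ℚ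
  cast n = + n ℚ./ 1

  cast-suc : ∀ n → cast (suc n) ≡ 1ℚ ℚ.+ cast n
  cast-suc n = trans (suc-/ n 0) (ℚ.+-comm (cast n) 1ℚ)

  0≤cast : ∀ n → 0ℚ ℚ.≤ cast n
  0≤cast zero    = ℚ.≤-refl
  0≤cast (suc n) = subst (0ℚ ℚ.≤_) (sym (cast-suc n)) (0≤1 ⊕ 0≤cast n)

  infixr 8 _^ℚ_
  _^ℚ_ : ℚ → ℕ → ℚ
  q ^ℚ zero  = 1ℚ
  q ^ℚ suc n = q ℚ.* q ^ℚ n

  0≤q^n : 0ℚ ℚ.≤ q → ∀ n → 0ℚ ℚ.≤ q ^ℚ n
  0≤q^n 0≤q zero    = 0≤1
  0≤q^n 0≤q (suc n) = 0≤q ⊗ 0≤q^n 0≤q n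

  sum : ∀ {A : Set} → (A → ℚ) → List A → ℚ
  sum f []       = 0ℚ
  sum f (x ∷ xs) = f x ℚ.+ sum f xs

  -- Σ_{i<n} qⁱ f(i) in Horner form.
  horner : ℚ → (ℕ → ℚ) → ℕ → ℚ
  horner q f zero    = 0ℚ
  horner q f (suc n) = f 0 ℚ.+ q ℚ.* horner q (f ∘ suc) n

  -- The prefactor `p` is there for the induction: dropping the first term shifts the index and
  -- turns `p` into `p * q`.
  sum-applyUpTo : ∀ {A : Set} {f : A → ℚ} {g : ℕ → A} {h : ℕ → ℚ} p →
    (∀ i → f (g i) ≡ p ℚ.* (q ^ℚ i ℚ.* h i)) → ∀ n → sum f (applyUpTo g n) ≡ p ℚ.* horner q h n
  sum-applyUpTo p eq zero = sym (ℚ.*-zeroʳ p)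
  sum-applyUpTo {q} {h = h} p eq (suc n) = trans
    (cong₂ ℚ._+_ (eq 0) (sum-applyUpTo (p ℚ.* q) (λ i → trans (eq (suc i)) (assoc p q (q ^ℚ i) (h (suc i)))) n))
    (factor p q (h 0) (horner q (h ∘ suc) n))
    where
    assoc : ∀ p q r s → p ℚ.* ((q ℚ.* r) ℚ.* s) ≡ (p ℚ.* q) ℚ.* (r ℚ.* s)
    assoc = solve-∀ ℚ-ring
    factor : ∀ p q a b → p ℚ.* (1ℚ ℚ.* a) ℚ.+ (p ℚ.* q) ℚ.* b ≡ p ℚ.* (a ℚ.+ q ℚ.* b)
    factor = solve-∀ ℚ-ring

open RationalOrder

cast-+ : ∀ m n → cast (m ℕ.+ n) ≡ cast m ℚ.+ cast n
cast-+ zero    n = sym (ℚ.+-identityˡ (cast n))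
cast-+ (suc m) n = begin
  cast (suc (m ℕ.+ n))          ≡⟨ cast-suc (m ℕ.+ n) ⟩
  1ℚ ℚ.+ cast (m ℕ.+ n)         ≡⟨ cong (1ℚ ℚ.+_) (cast-+ m n) ⟩
  1ℚ ℚ.+ (cast m ℚ.+ cast n)    ≡⟨ sym (ℚ.+-assoc 1ℚ (cast m) (cast n)) ⟩
  1ℚ ℚ.+ cast m ℚ.+ cast n      ≡⟨ cong (ℚ._+ cast n) (sym (cast-suc m)) ⟩
  cast (suc m) ℚ.+ cast n       ∎
  where open ≡-Reasoning

cast-* : ∀ m n → cast (m ℕ.* n) ≡ cast m ℚ.* cast n
cast-* zero    n = sym (ℚ.*-zeroˡ (cast n))
cast-* (suc m) n = begin
  cast (n ℕ.+ m ℕ.* n)                ≡⟨ cast-+ n (m ℕ.* n) ⟩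
  cast n ℚ.+ cast (m ℕ.* n)           ≡⟨ cong (cast n ℚ.+_) (cast-* m n) ⟩
  cast n ℚ.+ cast m ℚ.* cast n        ≡⟨ factor (cast m) (cast n) ⟩
  (1ℚ ℚ.+ cast m) ℚ.* cast n          ≡⟨ cong (ℚ._* cast n) (sym (cast-suc m)) ⟩
  cast (suc m) ℚ.* cast n             ∎
  where
  open ≡-Reasoning
  factor : ∀ p q → q ℚ.+ p ℚ.* q ≡ (1ℚ ℚ.+ p) ℚ.* q
  factor = solve-∀ ℚ-ring

cast-mono-≤ : ∀ {m n} → m ℕ.≤ n → cast m ℚ.≤ cast n
cast-mono-≤ {m} {n} m≤n = /-mono-≤ m 0 n 0 (ℕ.*-monoˡ-≤ 1 m≤n)

cast-mono-< : ∀ {m n} → m ℕ.< n → cast m ℚ.< cast n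
cast-mono-< {m} {n} m<n = /-mono-< m 0 n 0 (ℕ.*-monoˡ-< 1 m<n)

0<cast-suc : ∀ n → 0ℚ ℚ.< cast (suc n)
0<cast-suc n = cast-mono-< {0} {suc n} (s≤s z≤n)

/-*-cast : ∀ a n → + a ℚ./ suc n ℚ.* cast (suc n) ≡ cast a
/-*-cast a n = ℚ.toℚᵘ-injective (begin
  ℚ.toℚᵘ (+ a ℚ./ suc n ℚ.* cast (suc n))             ≈⟨ ℚ.toℚᵘ-homo-* (+ a ℚ./ suc n) (cast (suc n)) ⟩
  ℚ.toℚᵘ (+ a ℚ./ suc n) ℚᵘ.* ℚ.toℚᵘ (cast (suc n))   ≈⟨ ℚᵘ.*-cong (ℚ.toℚᵘ-fromℚᵘ (mkℚᵘ (+ a) n)) (ℚ.toℚᵘ-fromℚᵘ (mkℚᵘ (+ suc n) 0)) ⟩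
  mkℚᵘ (+ a) n ℚᵘ.* mkℚᵘ (+ suc n) 0                  ≈⟨ *≡* (ℤ.*-assoc (+ a) (+ suc n) (+ 1)) ⟩
  mkℚᵘ (+ a) 0                                        ≈⟨ ℚᵘ.≃-sym (ℚ.toℚᵘ-fromℚᵘ (mkℚᵘ (+ a) 0)) ⟩
  ℚ.toℚᵘ (cast a)                                     ∎)
  where open ℚᵘ.≃-Reasoning

-- The unary code

-- A list of Booleans encodes a set of keys by decreasing weight: `true` at position `i` means that
-- the key of weight `q ^ℚ i` is present. Here `s` is the disjoint union of `a` and `b`.
data Interleaving : List Bool → List Bool → List Bool → Set where
  []      : Interleaving [] [] []
  neither : ∀ {s a b} → Interleaving s a b → Interleaving (false ∷ s) (false ∷ a) (false ∷ b)
  left    : ∀ {s a b} → Interleaving s a b → Interleaving (true ∷ s) (true ∷ a) (false ∷ b)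
  right   : ∀ {s a b} → Interleaving s a b → Interleaving (true ∷ s) (false ∷ a) (true ∷ b)

swap : ∀ {s a b} → Interleaving s a b → Interleaving s b a
swap []          = []
swap (neither i) = neither (swap i)
swap (left i)    = right (swap i)
swap (right i)   = left (swap i)

left-empty : ∀ {s a b} → Interleaving s a b → or a ≡ false → s ≡ b
left-empty []          _ = refl
left-empty (neither i) e = cong (false ∷_) (left-empty i e)
left-empty (right i)   e = cong (true ∷_) (left-empty i e)

module UnaryCode (q : ℚ) (0≤q : 0ℚ ℚ.≤ q) (q+q²≤1 : q ℚ.+ q ℚ.* q ℚ.≤ 1ℚ) where
  weigh : List Bool → ℚ
  weigh []          = 0ℚ
  weigh (false ∷ s) = q ℚ.* weigh s
  weigh (true ∷ s)  = 1ℚ ℚ.+ q ℚ.* weigh s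

  -- Weight at the internal node of a key of weight 1 that directly precedes `s`; without later keys
  -- there is no such node.
  root : List Bool → ℚ
  root s = if or s then 1ℚ ℚ.+ q ℚ.* weigh s else 0ℚ

  -- The cost of the unary code for s: every key but the last one has an internal
  -- node of its own, which counts with the weight of that key and of all later ones.
  unary : List Bool → ℚ
  unary []          = 0ℚ
  unary (false ∷ s) = q ℚ.* unary s
  unary (true ∷ s)  = q ℚ.* unary s ℚ.+ root s

  0≤weigh : ∀ s → 0ℚ ℚ.≤ weigh s
  0≤weigh []          = ℚ.≤-refl
  0≤weigh (false ∷ s) = 0≤q ⊗ 0≤weigh s
  0≤weigh (true ∷ s)  = 0≤1 ⊕ 0≤q ⊗ 0≤weigh s

  0≤root : ∀ s → 0ℚ ℚ.≤ root s
  0≤root s with or s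
  ... | false = ℚ.≤-refl
  ... | true  = 0≤1 ⊕ 0≤q ⊗ 0≤weigh s

  root≤ : ∀ s → root s ℚ.≤ 1ℚ ℚ.+ q ℚ.* weigh s
  root≤ s with or s
  ... | false = 0≤1 ⊕ 0≤q ⊗ 0≤weigh s
  ... | true  = ℚ.≤-refl

  0≤unary : ∀ s → 0ℚ ℚ.≤ unary s
  0≤unary []          = ℚ.≤-refl
  0≤unary (false ∷ s) = 0≤q ⊗ 0≤unary s
  0≤unary (true ∷ s)  = 0≤q ⊗ 0≤unary s ⊕ 0≤root s

  q≤1 : q ℚ.≤ 1ℚ
  q≤1 = ≤-by (p≤q⇒0≤q-p q+q²≤1 ⊕ 0≤q ⊗ 0≤q) (eq q)
    where
    eq : ∀ q → 1ℚ ℚ.- q ≡ (1ℚ ℚ.- (q ℚ.+ q ℚ.* q)) ℚ.+ q ℚ.* q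
    eq = solve-∀ ℚ-ring

  -- Here the golden ratio enters: a key in front of `s` changes the sum into `q²` plus `q` times
  -- the old one, which is at most `q² + q`.
  q²*weigh≤1 : ∀ s → q ℚ.* (q ℚ.* weigh s) ℚ.≤ 1ℚ
  q²*weigh≤1 [] = ≤-by 0≤1 (eq q)
    where
    eq : ∀ q → 1ℚ ℚ.- q ℚ.* (q ℚ.* 0ℚ) ≡ 1ℚ
    eq = solve-∀ ℚ-ring
  q²*weigh≤1 (false ∷ s) =
    ≤-by (p≤q⇒0≤q-p q≤1 ⊕ 0≤q ⊗ p≤q⇒0≤q-p (q²*weigh≤1 s)) (eq q (weigh s))
    where
    eq : ∀ q w → 1ℚ ℚ.- q ℚ.* (q ℚ.* (q ℚ.* w)) ≡ (1ℚ ℚ.- q) ℚ.+ q ℚ.* (1ℚ ℚ.- q ℚ.* (q ℚ.* w))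
    eq = solve-∀ ℚ-ring
  q²*weigh≤1 (true ∷ s) =
    ≤-by (p≤q⇒0≤q-p q+q²≤1 ⊕ 0≤q ⊗ p≤q⇒0≤q-p (q²*weigh≤1 s)) (eq q (weigh s))
    where
    eq : ∀ q w → 1ℚ ℚ.- q ℚ.* (q ℚ.* (1ℚ ℚ.+ q ℚ.* w)) ≡ (1ℚ ℚ.- (q ℚ.+ q ℚ.* q)) ℚ.+ q ℚ.* (1ℚ ℚ.- q ℚ.* (q ℚ.* w))
    eq = solve-∀ ℚ-ring

  weigh-+ : ∀ {s a b} → Interleaving s a b → weigh s ≡ weigh a ℚ.+ weigh b
  weigh-+ [] = refl
  weigh-+ (neither {_} {a} {b} i) =
    trans (cong (q ℚ.*_) (weigh-+ i)) (ℚ.*-distribˡ-+ q (weigh a) (weigh b))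
  weigh-+ (left {_} {a} {b} i) =
    trans (cong (λ w → 1ℚ ℚ.+ q ℚ.* w) (weigh-+ i)) (eq q (weigh a) (weigh b))
    where
    eq : ∀ q a b → 1ℚ ℚ.+ q ℚ.* (a ℚ.+ b) ≡ (1ℚ ℚ.+ q ℚ.* a) ℚ.+ q ℚ.* b
    eq = solve-∀ ℚ-ring
  weigh-+ (right {_} {a} {b} i) =
    trans (cong (λ w → 1ℚ ℚ.+ q ℚ.* w) (weigh-+ i)) (eq q (weigh a) (weigh b))
    where
    eq : ∀ q a b → 1ℚ ℚ.+ q ℚ.* (a ℚ.+ b) ≡ q ℚ.* a ℚ.+ (1ℚ ℚ.+ q ℚ.* b)
    eq = solve-∀ ℚ-ring

  -- The first bound says that a root separating a from b cannot beat the unary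
  -- code.  The other two are what a key preceding s needs for its own first bound.
  record Bounds (s a b : List Bool) : Set where
    constructor bounds
    field
      merge   : unary s ℚ.≤ weigh s ℚ.+ (unary a ℚ.+ unary b)
      behindˡ : q ℚ.* unary s ℚ.≤ q ℚ.* unary a ℚ.+ q ℚ.* unary b ℚ.+ (1ℚ ℚ.+ q ℚ.* weigh a)
      behindʳ : q ℚ.* unary s ℚ.≤ q ℚ.* unary a ℚ.+ q ℚ.* unary b ℚ.+ (1ℚ ℚ.+ q ℚ.* weigh b)

  Bounds-swap : ∀ {s a b} → Bounds s a b → Bounds s b a
  Bounds-swap {s} {a} {b} (bounds m l r) = bounds
    (subst (λ x → unary s ℚ.≤ weigh s ℚ.+ x) (ℚ.+-comm (unary a) (unary b)) m)
    (subst (λ x → q ℚ.* unary s ℚ.≤ x ℚ.+ (1ℚ ℚ.+ q ℚ.* weigh b)) (ℚ.+-comm (q ℚ.* unary a) (q ℚ.* unary b)) r)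
    (subst (λ x → q ℚ.* unary s ℚ.≤ x ℚ.+ (1ℚ ℚ.+ q ℚ.* weigh a)) (ℚ.+-comm (q ℚ.* unary a) (q ℚ.* unary b)) l)

  -- Multiply the merge bound by `q` and split `weigh s`: the share of `a` is already on the right,
  -- and that of `b` is covered by the 1.
  merge⇒behindˡ : ∀ {s a b} → weigh s ≡ weigh a ℚ.+ weigh b → q ℚ.* weigh b ℚ.≤ 1ℚ →
    unary s ℚ.≤ weigh s ℚ.+ (unary a ℚ.+ unary b) →
    q ℚ.* unary s ℚ.≤ q ℚ.* unary a ℚ.+ q ℚ.* unary b ℚ.+ (1ℚ ℚ.+ q ℚ.* weigh a)
  merge⇒behindˡ {s} {a} {b} ws≡ qwb≤1 m =
    ≤-by (0≤q ⊗ p≤q⇒0≤q-p (subst (λ w → unary s ℚ.≤ w ℚ.+ (unary a ℚ.+ unary b)) ws≡ m) ⊕ p≤q⇒0≤q-p qwb≤1)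
      (eq q (unary s) (unary a) (unary b) (weigh a) (weigh b))
    where
    eq : ∀ q us ua ub wa wb → (q ℚ.* ua ℚ.+ q ℚ.* ub ℚ.+ (1ℚ ℚ.+ q ℚ.* wa)) ℚ.- q ℚ.* us
      ≡ q ℚ.* (((wa ℚ.+ wb) ℚ.+ (ua ℚ.+ ub)) ℚ.- us) ℚ.+ (1ℚ ℚ.- q ℚ.* wb)
    eq = solve-∀ ℚ-ring

  Bounds-neither : ∀ {s a b} → Interleaving s a b → Bounds s a b →
    Bounds (false ∷ s) (false ∷ a) (false ∷ b)
  Bounds-neither {s} {a} {b} i (bounds m _ _) = bounds m′
    -- Both parts start with a gap, so `q` times either weight is `q²` times that of its tail, hence
    -- at most 1.
    (merge⇒behindˡ {false ∷ s} {false ∷ a} {false ∷ b} (weigh-+ (neither i)) (q²*weigh≤1 b) m′)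
    (subst (λ x → q ℚ.* unary (false ∷ s) ℚ.≤ x ℚ.+ (1ℚ ℚ.+ q ℚ.* weigh (false ∷ b)))
      (ℚ.+-comm (q ℚ.* unary (false ∷ b)) (q ℚ.* unary (false ∷ a)))
      (merge⇒behindˡ {false ∷ s} {false ∷ b} {false ∷ a} (weigh-+ (swap (neither i))) (q²*weigh≤1 a)
        (subst (λ x → q ℚ.* unary s ℚ.≤ q ℚ.* weigh s ℚ.+ x) (ℚ.+-comm (q ℚ.* unary a) (q ℚ.* unary b)) m′)))
    where
    eq : ∀ q us ws ua ub → (q ℚ.* ws ℚ.+ (q ℚ.* ua ℚ.+ q ℚ.* ub)) ℚ.- q ℚ.* us ≡ q ℚ.* ((ws ℚ.+ (ua ℚ.+ ub)) ℚ.- us)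
    eq = solve-∀ ℚ-ring
    m′ : unary (false ∷ s) ℚ.≤ weigh (false ∷ s) ℚ.+ (unary (false ∷ a) ℚ.+ unary (false ∷ b))
    m′ = ≤-by (0≤q ⊗ p≤q⇒0≤q-p m) (eq q (unary s) (weigh s) (unary a) (unary b))

  -- If the new key is alone in its part, the rest is `b` and the new root pays for it. Otherwise
  -- the part `true ∷ a` gets a root of weight `1 + q * weigh a`, which is what `behindˡ` needs.
  merge-left : ∀ {s a b} → Interleaving s a b → Bounds s a b →
    unary (true ∷ s) ℚ.≤ weigh (true ∷ s) ℚ.+ (unary (true ∷ a) ℚ.+ unary (false ∷ b))
  merge-left {s} {a} {b} i (bounds _ l _) with or a in eq
  ... | false rewrite left-empty i eq =
    ≤-by (p≤q⇒0≤q-p (root≤ b) ⊕ 0≤q ⊗ 0≤unary a) (cert q (unary a) (unary b) (weigh b) (root b))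
    where
    cert : ∀ q ua ub wb t → (1ℚ ℚ.+ q ℚ.* wb ℚ.+ ((q ℚ.* ua ℚ.+ 0ℚ) ℚ.+ q ℚ.* ub)) ℚ.- (q ℚ.* ub ℚ.+ t)
      ≡ ((1ℚ ℚ.+ q ℚ.* wb) ℚ.- t) ℚ.+ q ℚ.* ua
    cert = solve-∀ ℚ-ring
  ... | true =
    ≤-by (p≤q⇒0≤q-p (root≤ s) ⊕ p≤q⇒0≤q-p l)
      (cert q (unary s) (unary a) (unary b) (weigh s) (weigh a) (root s))
    where
    cert : ∀ q us ua ub ws wa t →
      (1ℚ ℚ.+ q ℚ.* ws ℚ.+ ((q ℚ.* ua ℚ.+ (1ℚ ℚ.+ q ℚ.* wa)) ℚ.+ q ℚ.* ub)) ℚ.- (q ℚ.* us ℚ.+ t)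
      ≡ ((1ℚ ℚ.+ q ℚ.* ws) ℚ.- t) ℚ.+ ((q ℚ.* ua ℚ.+ q ℚ.* ub ℚ.+ (1ℚ ℚ.+ q ℚ.* wa)) ℚ.- q ℚ.* us)
    cert = solve-∀ ℚ-ring

  -- `merge⇒behindˡ` does not apply on this side, since `q * weigh (true ∷ a)` may exceed 1. The
  -- root that the new key contributes to its own part compensates, unless the key is alone there;
  -- then `q` at most 1 suffices.
  behindʳ-left : ∀ {s a b} → Interleaving s a b → Bounds s a b →
    q ℚ.* unary (true ∷ s) ℚ.≤
      q ℚ.* unary (true ∷ a) ℚ.+ q ℚ.* unary (false ∷ b) ℚ.+ (1ℚ ℚ.+ q ℚ.* weigh (false ∷ b))
  behindʳ-left {s} {a} {b} i (bounds m _ _) with or a in eq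
  ... | false rewrite left-empty i eq =
    ≤-by (0≤q ⊗ p≤q⇒0≤q-p (root≤ b) ⊕ p≤q⇒0≤q-p q≤1 ⊕ 0≤q ⊗ (0≤q ⊗ 0≤unary a))
      (cert q (unary a) (unary b) (weigh b) (root b))
    where
    cert : ∀ q ua ub wb t →
      (q ℚ.* (q ℚ.* ua ℚ.+ 0ℚ) ℚ.+ q ℚ.* (q ℚ.* ub) ℚ.+ (1ℚ ℚ.+ q ℚ.* (q ℚ.* wb))) ℚ.- q ℚ.* (q ℚ.* ub ℚ.+ t)
      ≡ q ℚ.* ((1ℚ ℚ.+ q ℚ.* wb) ℚ.- t) ℚ.+ (1ℚ ℚ.- q) ℚ.+ q ℚ.* (q ℚ.* ua)
    cert = solve-∀ ℚ-ring
  ... | true =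
    -- The merge bound times `q²` costs an extra `q² * weigh s`, which the spare 1 absorbs.
    ≤-by (0≤q ⊗ p≤q⇒0≤q-p root≤′ ⊕ 0≤q ⊗ (0≤q ⊗ p≤q⇒0≤q-p m) ⊕ p≤q⇒0≤q-p (q²*weigh≤1 s))
      (cert q (unary s) (unary a) (unary b) (weigh s) (weigh a) (weigh b) (root s))
    where
    root≤′ : root s ℚ.≤ 1ℚ ℚ.+ q ℚ.* (weigh a ℚ.+ weigh b)
    root≤′ = subst (λ w → root s ℚ.≤ 1ℚ ℚ.+ q ℚ.* w) (weigh-+ i) (root≤ s)
    cert : ∀ q us ua ub ws wa wb t →
      (q ℚ.* (q ℚ.* ua ℚ.+ (1ℚ ℚ.+ q ℚ.* wa)) ℚ.+ q ℚ.* (q ℚ.* ub) ℚ.+ (1ℚ ℚ.+ q ℚ.* (q ℚ.* wb))) ℚ.- q ℚ.* (q ℚ.* us ℚ.+ t)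
      ≡ q ℚ.* ((1ℚ ℚ.+ q ℚ.* (wa ℚ.+ wb)) ℚ.- t) ℚ.+ q ℚ.* (q ℚ.* ((ws ℚ.+ (ua ℚ.+ ub)) ℚ.- us)) ℚ.+ (1ℚ ℚ.- q ℚ.* (q ℚ.* ws))
    cert = solve-∀ ℚ-ring

  Bounds-left : ∀ {s a b} → Interleaving s a b → Bounds s a b →
    Bounds (true ∷ s) (true ∷ a) (false ∷ b)
  Bounds-left {s} {a} {b} i h = bounds (merge-left i h)
    (merge⇒behindˡ {true ∷ s} {true ∷ a} {false ∷ b} (weigh-+ (left i)) (q²*weigh≤1 b) (merge-left i h))
    (behindʳ-left i h)

  bounds-hold : ∀ {s a b} → Interleaving s a b → Bounds s a b
  bounds-hold []          = bounds ℚ.≤-refl base base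
    where
    base : q ℚ.* 0ℚ ℚ.≤ q ℚ.* 0ℚ ℚ.+ q ℚ.* 0ℚ ℚ.+ (1ℚ ℚ.+ q ℚ.* 0ℚ)
    base = ≤-by 0≤1 (eq q)
      where
      eq : ∀ q → (q ℚ.* 0ℚ ℚ.+ q ℚ.* 0ℚ ℚ.+ (1ℚ ℚ.+ q ℚ.* 0ℚ)) ℚ.- q ℚ.* 0ℚ ≡ 1ℚ
      eq = solve-∀ ℚ-ring
  bounds-hold (neither i) = Bounds-neither i (bounds-hold i)
  bounds-hold (left i)    = Bounds-left i (bounds-hold i)
  bounds-hold (right i)   = Bounds-swap (Bounds-left (swap i) (Bounds-swap (bounds-hold i)))

-- Prefix-free codes

Code : Set
Code = ℕ → Maybe Address

occupied : Code → ℕ → List Bool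
occupied c = applyUpTo (is-just ∘ c)

PrefixFree : Code → Set
PrefixFree c = ∀ {i j a b} → c i ≡ just a → c j ≡ just (a ++ b) → i ≡ j

-- Applied to a code, this gives the code of the subtree behind the answer `b`; `nothing` marks the
-- keys that are absent from it.
strip : Bool → Maybe Address → Maybe Address
strip true  (just (true ∷ a))  = just a
strip false (just (false ∷ a)) = just a
strip _     _                  = nothing

strip-just : ∀ b m {a} → strip b m ≡ just a → m ≡ just (b ∷ a)
strip-just true  (just (true ∷ a))   refl = refl
strip-just false (just (false ∷ a))  refl = refl
strip-just true  nothing             ()
strip-just true  (just [])           ()
strip-just true  (just (false ∷ _))  ()
strip-just false nothing             ()
strip-just false (just [])           ()
strip-just false (just (true ∷ _))   ()

strip-PrefixFree : ∀ b {c} → PrefixFree c → PrefixFree (strip b ∘ c)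
strip-PrefixFree b {c} pf {i} {j} ci cj = pf (strip-just b (c i) ci) (strip-just b (c j) cj)

-- The bound `D` is the recursion measure of `unary-optimal′`.
ShorterThan : ℕ → Code → ℕ → Set
ShorterThan D c n = ∀ {i a} → i ℕ.< n → c i ≡ just a → length a ℕ.< D

strip-ShorterThan : ∀ b {D c n} → ShorterThan (suc D) c n → ShorterThan D (strip b ∘ c) n
strip-ShorterThan b {c = c} short {i} i<n e = ℕ.≤-pred (short i<n (strip-just b (c i) e))

ShorterThan-exists : ∀ c n → ∃[ D ] ShorterThan D c n
ShorterThan-exists c zero = 0 , λ ()
ShorterThan-exists c (suc n) with D , short ← ShorterThan-exists (c ∘ suc) n | c 0 in eq
... | nothing = D , λ
  { {zero}  _         e → contradiction (trans (sym eq) e) λ ()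
  ; {suc i} (s≤s i<n) e → short i<n e }
... | just a = suc (length a) ℕ.⊔ D , λ
  { {zero}  _         e → ℕ.<-≤-trans (subst (λ b → length b ℕ.< suc (length a))
      (Maybe.just-injective (trans (sym eq) e)) ℕ.≤-refl) (ℕ.m≤m⊔n (suc (length a)) D)
  ; {suc i} (s≤s i<n) e → ℕ.<-≤-trans (short i<n e) (ℕ.m≤n⊔m (suc (length a)) D) }

RootFree : Code → ℕ → Set
RootFree c n = ∀ {i} → i ℕ.< n → c i ≢ just []

strip-Interleaving : ∀ c n → RootFree c n →
  Interleaving (occupied c n) (occupied (strip true ∘ c) n) (occupied (strip false ∘ c) n)
strip-Interleaving c zero    rf = []
strip-Interleaving c (suc n) rf with i ← strip-Interleaving (c ∘ suc) n (rf ∘ s≤s) | c 0 in eq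
... | nothing          = neither i
... | just []          = contradiction eq (rf (s≤s z≤n))
... | just (true ∷ _)  = left i
... | just (false ∷ _) = right i

or-true : ∀ f n → or (applyUpTo f n) ≡ true → ∃[ i ] i ℕ.< n × f i ≡ true
or-true f (suc n) e with f 0 in eq
... | true  = 0 , s≤s z≤n , eq
... | false with i , i<n , fi ← or-true (f ∘ suc) n e = suc i , s≤s i<n , fi

is-just-true : ∀ (m : Maybe Address) → is-just m ≡ true → ∃[ a ] m ≡ just a
is-just-true (just a) _ = a , refl

size : Maybe Address → ℚ
size nothing  = 0ℚ
size (just a) = cast (length a)

0≤size : ∀ m → 0ℚ ℚ.≤ size m
0≤size nothing  = ℚ.≤-refl
0≤size (just a) = 0≤cast (length a)

module CodeCost (q : ℚ) (0≤q : 0ℚ ℚ.≤ q) (q+q²≤1 : q ℚ.+ q ℚ.* q ℚ.≤ 1ℚ) where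
  open UnaryCode q 0≤q q+q²≤1

  cost : Code → ℕ → ℚ
  cost c = horner q (size ∘ c)

  0≤cost : ∀ c n → 0ℚ ℚ.≤ cost c n
  0≤cost c zero    = ℚ.≤-refl
  0≤cost c (suc n) = 0≤size (c 0) ⊕ 0≤q ⊗ 0≤cost (c ∘ suc) n

  -- An internal node arises only at a key that is followed by another one.
  unary-single : ∀ f n →
    (∀ {i j} → i ℕ.< n → j ℕ.< n → f i ≡ true → f j ≡ true → i ≡ j) →
    unary (applyUpTo f n) ≡ 0ℚ
  unary-single f zero    single = refl
  unary-single f (suc n) single
    with tail ← unary-single (f ∘ suc) n (λ i<n j<n fi fj → ℕ.suc-injective (single (s≤s i<n) (s≤s j<n) fi fj))
       | f 0 in f0
  ... | false = trans (cong (q ℚ.*_) tail) (ℚ.*-zeroʳ q)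
  ... | true with or (applyUpTo (f ∘ suc) n) in o
  ...   | false = trans (cong (λ x → q ℚ.* x ℚ.+ 0ℚ) tail) (trans (ℚ.+-identityʳ (q ℚ.* 0ℚ)) (ℚ.*-zeroʳ q))
  ...   | true with i , i<n , fi ← or-true (f ∘ suc) n o =
    contradiction (single (s≤s z≤n) (s≤s i<n) f0 fi) λ ()

  -- Stripping shortens the address of each present key by one, which accounts for the weight of
  -- that key once.
  strip-cost : ∀ c n → RootFree c n → cost c n ≡
    weigh (occupied c n) ℚ.+ (cost (strip true ∘ c) n ℚ.+ cost (strip false ∘ c) n)
  strip-cost c zero    rf = refl
  strip-cost c (suc n) rf with tail ← strip-cost (c ∘ suc) n (rf ∘ s≤s) | c 0 in eq
  ... | nothing = trans (cong (λ x → 0ℚ ℚ.+ q ℚ.* x) tail) (regroup q _ _ _)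
    where
    regroup : ∀ q w a b → 0ℚ ℚ.+ q ℚ.* (w ℚ.+ (a ℚ.+ b)) ≡ q ℚ.* w ℚ.+ ((0ℚ ℚ.+ q ℚ.* a) ℚ.+ (0ℚ ℚ.+ q ℚ.* b))
    regroup = solve-∀ ℚ-ring
  ... | just [] = contradiction eq (rf (s≤s z≤n))
  ... | just (true ∷ a) =
    trans (cong₂ (λ x y → x ℚ.+ q ℚ.* y) (cast-suc (length a)) tail)
      (regroup q (cast (length a)) (weigh (occupied (c ∘ suc) n))
        (cost (strip true ∘ c ∘ suc) n) (cost (strip false ∘ c ∘ suc) n))
    where
    regroup : ∀ q s w a b → (1ℚ ℚ.+ s) ℚ.+ q ℚ.* (w ℚ.+ (a ℚ.+ b)) ≡ (1ℚ ℚ.+ q ℚ.* w) ℚ.+ ((s ℚ.+ q ℚ.* a) ℚ.+ (0ℚ ℚ.+ q ℚ.* b))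
    regroup = solve-∀ ℚ-ring
  ... | just (false ∷ a) =
    trans (cong₂ (λ x y → x ℚ.+ q ℚ.* y) (cast-suc (length a)) tail)
      (regroup q (cast (length a)) (weigh (occupied (c ∘ suc) n))
        (cost (strip true ∘ c ∘ suc) n) (cost (strip false ∘ c ∘ suc) n))
    where
    regroup : ∀ q s w a b → (1ℚ ℚ.+ s) ℚ.+ q ℚ.* (w ℚ.+ (a ℚ.+ b)) ≡ (1ℚ ℚ.+ q ℚ.* w) ℚ.+ ((0ℚ ℚ.+ q ℚ.* a) ℚ.+ (s ℚ.+ q ℚ.* b))
    regroup = solve-∀ ℚ-ring

  -- Both subtrees satisfy the bound by induction, and `Bounds.merge` accounts for the root, also
  -- when one subtree holds all keys.
  unary-optimal′ : ∀ D c n → PrefixFree c → ShorterThan D c n → unary (occupied c n) ℚ.≤ cost c n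
  unary-optimal′ zero c n pf short = ℚ.≤-trans
    (ℚ.≤-reflexive (unary-single (is-just ∘ c) n λ {i} i<n _ ci _ →
      contradiction (short i<n (proj₂ (is-just-true (c i) ci))) λ ()))
    (0≤cost c n)
  unary-optimal′ (suc D) c n pf short
    with ℕ.anyUpTo? (λ i → Maybe.≡-dec (List.≡-dec Bool._≟_) (c i) (just [])) n
  -- The empty address is a prefix of every other, so `k` is the only key.
  ... | yes (k , _ , ck) = ℚ.≤-trans
    (ℚ.≤-reflexive (unary-single (is-just ∘ c) n λ {i} {j} _ _ ci cj →
      trans (sym (pf ck (proj₂ (is-just-true (c i) ci)))) (pf ck (proj₂ (is-just-true (c j) cj)))))
    (0≤cost c n)
  ... | no ¬root = begin
    unary (occupied c n)
      ≤⟨ Bounds.merge (bounds-hold (strip-Interleaving c n rf)) ⟩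
    weigh (occupied c n) ℚ.+ (unary (occupied (strip true ∘ c) n) ℚ.+ unary (occupied (strip false ∘ c) n))
      ≤⟨ ℚ.+-monoʳ-≤ (weigh (occupied c n)) (ℚ.+-mono-≤ (stripped true) (stripped false)) ⟩
    weigh (occupied c n) ℚ.+ (cost (strip true ∘ c) n ℚ.+ cost (strip false ∘ c) n)
      ≡⟨ sym (strip-cost c n rf) ⟩
    cost c n ∎
    where
    open ℚ.≤-Reasoning
    rf : RootFree c n
    rf {i} i<n ci = ¬root (i , i<n , ci)
    stripped : ∀ b → unary (occupied (strip b ∘ c) n) ℚ.≤ cost (strip b ∘ c) n
    stripped b = unary-optimal′ D (strip b ∘ c) n (strip-PrefixFree b {c} pf)
      (strip-ShorterThan b {D} {c} {n} short)

  unary-optimal : ∀ c n → PrefixFree c → unary (occupied c n) ℚ.≤ cost c n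
  unary-optimal c n pf with D , short ← ShorterThan-exists c n = unary-optimal′ D c n pf short

  -- Comparison with linear depths

  initial : ℕ → List Bool
  initial = applyUpTo (λ _ → true)

  horner-1+ : ∀ {f g} → (∀ i → f i ≡ 1ℚ ℚ.+ g i) → ∀ n → horner q f n ≡ weigh (initial n) ℚ.+ horner q g n
  horner-1+ eq zero = refl
  horner-1+ {g = g} eq (suc n) =
    trans (cong₂ (λ x y → x ℚ.+ q ℚ.* y) (eq 0) (horner-1+ (eq ∘ suc) n)) (regroup q (g 0) _ _)
    where
    regroup : ∀ q g w h → (1ℚ ℚ.+ g) ℚ.+ q ℚ.* (w ℚ.+ h) ≡ (1ℚ ℚ.+ q ℚ.* w) ℚ.+ (g ℚ.+ q ℚ.* h)
    regroup = solve-∀ ℚ-ring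

  weigh-initial-mono : ∀ n → weigh (initial n) ℚ.≤ weigh (initial (suc n))
  weigh-initial-mono zero = 0≤weigh (true ∷ [])
  weigh-initial-mono (suc n) =
    ℚ.+-monoʳ-≤ 1ℚ (ℚ.*-monoˡ-≤-nonNeg q {{ℚ.nonNegative 0≤q}} (weigh-initial-mono n))

  -- The unary code for `suc n` keys has depths 1, 2, ..., `n`, `n`. Only the last key lies higher
  -- than in the infinite chain, so the chain is compared on one key fewer.
  linear≤unary : ∀ n → horner q (cast ∘ suc) n ℚ.≤ unary (initial (suc n))
  linear≤unary zero    = 0≤unary (initial 1)
  linear≤unary (suc n) = begin
    1ℚ ℚ.+ q ℚ.* horner q (cast ∘ suc ∘ suc) n
      ≡⟨ cong (λ x → 1ℚ ℚ.+ q ℚ.* x) (horner-1+ (cast-suc ∘ suc) n) ⟩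
    1ℚ ℚ.+ q ℚ.* (weigh (initial n) ℚ.+ horner q (cast ∘ suc) n)
      ≤⟨ ≤-by (0≤q ⊗ p≤q⇒0≤q-p (weigh-initial-mono n) ⊕ 0≤q ⊗ p≤q⇒0≤q-p (linear≤unary n))
          (cert q (weigh (initial n)) (weigh (initial (suc n))) _ (unary (initial (suc n)))) ⟩
    q ℚ.* unary (initial (suc n)) ℚ.+ (1ℚ ℚ.+ q ℚ.* weigh (initial (suc n))) ∎
    where
    open ℚ.≤-Reasoning
    cert : ∀ q w w′ h u → (q ℚ.* u ℚ.+ (1ℚ ℚ.+ q ℚ.* w′)) ℚ.- (1ℚ ℚ.+ q ℚ.* (w ℚ.+ h)) ≡ q ℚ.* (w′ ℚ.- w) ℚ.+ q ℚ.* (u ℚ.- h)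
    cert = solve-∀ ℚ-ring

  linear-optimal : ∀ (a : ℕ → Address) → PrefixFree (just ∘ a) → ∀ n →
    horner q (cast ∘ suc) n ℚ.≤ horner q (cast ∘ length ∘ a) (suc n)
  linear-optimal a pf n = ℚ.≤-trans (linear≤unary n) (unary-optimal (just ∘ a) (suc n) pf)

-- Real numbers

5ℚ : ℚ
5ℚ = cast 5

cast-square : ∀ b n → cast (b ℕ.* b) ≡
  (+ b ℚ./ suc n ℚ.* (+ b ℚ./ suc n)) ℚ.* (cast (suc n) ℚ.* cast (suc n))
cast-square b n = trans (cast-* b b)
  (trans (cong₂ ℚ._*_ (sym (/-*-cast b n)) (sym (/-*-cast b n))) (regroup (+ b ℚ./ suc n) (cast (suc n))))
  where
  regroup : ∀ p q → (p ℚ.* q) ℚ.* (p ℚ.* q) ≡ (p ℚ.* p) ℚ.* (q ℚ.* q)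
  regroup = solve-∀ ℚ-ring

cast-5* : ∀ n → cast (5 ℕ.* (suc n ℕ.* suc n)) ≡ 5ℚ ℚ.* (cast (suc n) ℚ.* cast (suc n))
cast-5* n = trans (cast-* 5 (suc n ℕ.* suc n)) (cong (5ℚ ℚ.*_) (cast-* (suc n) (suc n)))

0<cast-suc² : ∀ n → 0ℚ ℚ.< cast (suc n) ℚ.* cast (suc n)
0<cast-suc² n = 0<p*q {cast (suc n)} {cast (suc n)} (0<cast-suc n) (0<cast-suc n)

√5²≤5 : ∀ n → √-seq 5 n ℚ.* √-seq 5 n ℚ.≤ 5ℚ
√5²≤5 n = ℚ.*-cancelʳ-≤-pos (cast (suc n) ℚ.* cast (suc n)) {{ℚ.positive (0<cast-suc² n)}}
  (subst₂ ℚ._≤_ (cast-square ⌊√ 5 ℕ.* (suc n ℕ.* suc n) ⌋ n) (cast-5* n)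
    (cast-mono-≤ (⌊√⌋²≤ (5 ℕ.* (suc n ℕ.* suc n)))))

5<√5⁺² : ∀ n → 5ℚ ℚ.< (√-seq 5 n ℚ.+ + 1 ℚ./ suc n) ℚ.* (√-seq 5 n ℚ.+ + 1 ℚ./ suc n)
5<√5⁺² n = subst (λ p → 5ℚ ℚ.< p ℚ.* p) (suc-/ ⌊√ 5 ℕ.* (suc n ℕ.* suc n) ⌋ n)
  (ℚ.*-cancelʳ-<-nonNeg (cast (suc n) ℚ.* cast (suc n)) {{ℚ.nonNegative (ℚ.<⇒≤ (0<cast-suc² n))}}
    (subst₂ ℚ._<_ (cast-5* n) (cast-square (suc ⌊√ 5 ℕ.* (suc n ℕ.* suc n) ⌋) n)
      (cast-mono-< (<⌊√⌋+1² (5 ℕ.* (suc n ℕ.* suc n))))))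

γ₀ : ℝ
γ₀ = (√ 5 - 1ℝ) * ½ℝ

-- With `r` for `√-seq 5 n`, the hypothesis gives `2q + 1 ≤ r`; squaring and `r² ≤ 5` yield
-- `4(q + q²) ≤ 4`. The approximants of the root never exceed it, so this works at every index.
below-γ₀ : ∀ q n → 0ℚ ℚ.≤ q → q ℚ.≤ seq γ₀ n → q ℚ.+ q ℚ.* q ℚ.≤ 1ℚ
below-γ₀ q n 0≤q q≤γ₀ = ≤-by
  (0≤½ ⊗ 0≤½ ⊗ (p≤q⇒0≤q-p (√5²≤5 n) ⊕ 2x ⊗ (2x ⊕ 2y)))
  (cert q (√-seq 5 n))
  where
  0≤½ : 0ℚ ℚ.≤ ½
  0≤½ = ℚ.<⇒≤ 0<½
  x = p≤q⇒0≤q-p q≤γ₀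
  2x = x ⊕ x
  2y = (0≤q ⊕ 0≤q ⊕ 0≤1) ⊕ (0≤q ⊕ 0≤q ⊕ 0≤1)
  cert : ∀ q r → 1ℚ ℚ.- (q ℚ.+ q ℚ.* q) ≡ ½ ℚ.* ½ ℚ.* ((5ℚ ℚ.- r ℚ.* r) ℚ.+
    (((r ℚ.+ ℚ.- 1ℚ) ℚ.* ½ ℚ.- q) ℚ.+ ((r ℚ.+ ℚ.- 1ℚ) ℚ.* ½ ℚ.- q)) ℚ.*
    ((((r ℚ.+ ℚ.- 1ℚ) ℚ.* ½ ℚ.- q) ℚ.+ ((r ℚ.+ ℚ.- 1ℚ) ℚ.* ½ ℚ.- q)) ℚ.+
     ((q ℚ.+ q ℚ.+ 1ℚ) ℚ.+ (q ℚ.+ q ℚ.+ 1ℚ))))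
  cert = solve-∀ ℚ-ring

-- Finite sums

sum-mono : ∀ {A : Set} {f g : A → ℚ} → (∀ x → f x ℚ.≤ g x) → ∀ xs → sum f xs ℚ.≤ sum g xs
sum-mono f≤g []       = ℚ.≤-refl
sum-mono f≤g (x ∷ xs) = ℚ.+-mono-≤ (f≤g x) (sum-mono f≤g xs)

sum-insert : ∀ {A : Set} (f : A → ℚ) as {x bs} → sum f (as ++ x ∷ bs) ≡ f x ℚ.+ sum f (as ++ bs)
sum-insert f []       = refl
sum-insert f (a ∷ as) {x} {bs} =
  trans (cong (f a ℚ.+_) (sum-insert f as)) (exchange (f a) (f x) (sum f (as ++ bs)))
  where
  exchange : ∀ p q r → p ℚ.+ (q ℚ.+ r) ≡ q ℚ.+ (p ℚ.+ r)
  exchange = solve-∀ ℚ-ring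

∈-remove : ∀ {A : Set} as {x y : A} {bs} → x ≢ y → y ∈ as ++ x ∷ bs → y ∈ as ++ bs
∈-remove []       x≢y (here refl) = contradiction refl x≢y
∈-remove []       x≢y (there y∈)  = y∈
∈-remove (a ∷ as) x≢y (here refl) = here refl
∈-remove (a ∷ as) x≢y (there y∈)  = there (∈-remove as x≢y y∈)

sum-nonNeg : ∀ {A : Set} {f : A → ℚ} → (∀ x → 0ℚ ℚ.≤ f x) → ∀ xs → 0ℚ ℚ.≤ sum f xs
sum-nonNeg 0≤f []       = ℚ.≤-refl
sum-nonNeg 0≤f (x ∷ xs) = 0≤f x ⊕ sum-nonNeg 0≤f xs

sum-⊆ : ∀ {A : Set} {f : A → ℚ} → (∀ x → 0ℚ ℚ.≤ f x) →
  ∀ {xs ys} → Unique xs → xs ⊆ ys → sum f xs ℚ.≤ sum f ys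
sum-⊆ 0≤f {[]} {ys} _ _ = sum-nonNeg 0≤f ys
sum-⊆ {f = f} 0≤f {x ∷ xs} (x∉xs ∷ u) xs⊆ys with as , bs , refl ← ∈-∃++ (xs⊆ys (here refl)) =
  ℚ.≤-trans
    (ℚ.+-monoʳ-≤ (f x) (sum-⊆ 0≤f u λ y∈xs → ∈-remove as (All.lookup x∉xs y∈xs) (xs⊆ys (there y∈xs))))
    (ℚ.≤-reflexive (sym (sum-insert f as)))

-- Order of the reals and weighted sums

≤ℝ-trans : ∀ {x y z} → x ≤ y → y ≤ z → x ≤ z
≤ℝ-trans {x} {y} {z} x≤y y≤z ε 0<ε
  with M , f ← x≤y (ε ℚ.* ½) (0<p*q 0<ε 0<½)
     | N , g ← y≤z (ε ℚ.* ½) (0<p*q 0<ε 0<½)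
  = M ℕ.⊔ N , λ n p → ≤-by
    (p≤q⇒0≤q-p (f n (ℕ.m⊔n≤o⇒m≤o M N p)) ⊕ p≤q⇒0≤q-p (g n (ℕ.m⊔n≤o⇒n≤o M N p)))
    (cert (seq x n) (seq y n) (seq z n) ε)
  where
  cert : ∀ x y z ε → (z ℚ.+ ε) ℚ.- x ≡ ((y ℚ.+ ε ℚ.* ½) ℚ.- x) ℚ.+ ((z ℚ.+ ε ℚ.* ½) ℚ.- y)
  cert = solve-∀ ℚ-ring

p≤p+ε : ∀ {p q ε} → 0ℚ ℚ.< ε → p ℚ.≤ q → p ℚ.≤ q ℚ.+ ε
p≤p+ε {p} {q} {ε} 0<ε p≤q = subst (ℚ._≤ q ℚ.+ ε) (ℚ.+-identityʳ p) (ℚ.+-mono-≤ p≤q (ℚ.<⇒≤ 0<ε))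

eventually-≤ : ∀ {x y} → Eventually (λ n → seq x n ℚ.≤ seq y n) → x ≤ y
eventually-≤ (N , h) ε 0<ε = N , λ n p → p≤p+ε 0<ε (h n p)

∃-small : ∀ d {ε} → 0ℚ ℚ.< ε → ∃[ δ ] 0ℚ ℚ.< δ × δ ℚ.* cast d ℚ.≤ ε
-- Dividing by `suc d` instead of `d` covers `d = 0`.
∃-small d {ε} 0<ε = ε ℚ.* h , 0<p*q 0<ε (ℚ.positive⁻¹ h {{ℚ.1/pos⇒pos (cast (suc d))}})
  , ≤-by (ℚ.<⇒≤ (0<p*q 0<ε (ℚ.positive⁻¹ h {{ℚ.1/pos⇒pos (cast (suc d))}}))) (begin
    ε ℚ.- ε ℚ.* h ℚ.* cast d
      ≡⟨ cong (λ x → x ℚ.- ε ℚ.* h ℚ.* cast d) (trans (sym (ℚ.*-identityʳ ε)) (cong (ε ℚ.*_) (sym h*d≡1))) ⟩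
    ε ℚ.* (h ℚ.* (1ℚ ℚ.+ cast d)) ℚ.- ε ℚ.* h ℚ.* cast d
      ≡⟨ cancel ε h (cast d) ⟩
    ε ℚ.* h ∎)
  where
  open ≡-Reasoning
  instance
    d-pos : ℚ.Positive (cast (suc d))
    d-pos = ℚ.positive {cast (suc d)} (0<cast-suc d)
    d-nonZero : ℚ.NonZero (cast (suc d))
    d-nonZero = ℚ.pos⇒nonZero (cast (suc d))
  h = ℚ.1/ cast (suc d)
  h*d≡1 : h ℚ.* (1ℚ ℚ.+ cast d) ≡ 1ℚ
  h*d≡1 = trans (cong (h ℚ.*_) (sym (cast-suc d))) (ℚ.*-inverseˡ (cast (suc d)))
  cancel : ∀ ε h d → ε ℚ.* (h ℚ.* (1ℚ ℚ.+ d)) ℚ.- ε ℚ.* h ℚ.* d ≡ ε ℚ.* h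
  cancel = solve-∀ ℚ-ring

weightedSum : ∀ {K : Set} → (K → ℝ) → (K → ℕ) → List K → ℝ
weightedSum w d = foldr (λ k s → w k * fromℕ (d k) + s) 0ℝ

-- Serves to exchange the weights of an instance, known only up to `_≈_`, for the powers of `γ`. The
-- error allowed in a weight is chosen so small that it survives multiplication by the depth.
weightedSum-mono : ∀ {K : Set} {w w′ : K → ℝ} (d : K → ℕ) → (∀ k → w k ≤ w′ k) →
  ∀ ks → weightedSum w d ks ≤ weightedSum w′ d ks
weightedSum-mono d w≤w′ [] = eventually-≤ {0ℝ} {0ℝ} (0 , λ _ _ → ℚ.≤-refl)
weightedSum-mono {w = w} {w′} d w≤w′ (k ∷ ks) ε 0<ε =
  let δ , 0<δ , δd≤ε/2 = ∃-small (d k) (0<p*q 0<ε 0<½)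
      M , f            = w≤w′ k δ 0<δ
      N , g            = weightedSum-mono {w = w} {w′} d w≤w′ ks (ε ℚ.* ½) (0<p*q 0<ε 0<½)
  in M ℕ.⊔ N , λ n p → ≤-by
    (p≤q⇒0≤q-p (f n (ℕ.m⊔n≤o⇒m≤o M N p)) ⊗ 0≤cast (d k) ⊕ p≤q⇒0≤q-p (g n (ℕ.m⊔n≤o⇒n≤o M N p))
      ⊕ p≤q⇒0≤q-p δd≤ε/2)
    (cert (seq (w k) n) (seq (w′ k) n) (cast (d k)) δ ε
      (seq (weightedSum w d ks) n) (seq (weightedSum w′ d ks) n))
  where
  cert : ∀ w w′ d δ ε s s′ → ((w′ ℚ.* d ℚ.+ s′) ℚ.+ ε) ℚ.- (w ℚ.* d ℚ.+ s) ≡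
    ((w′ ℚ.+ δ) ℚ.- w) ℚ.* d ℚ.+ ((s′ ℚ.+ ε ℚ.* ½) ℚ.- s) ℚ.+ (ε ℚ.* ½ ℚ.- δ ℚ.* d)
  cert = solve-∀ ℚ-ring

term : ∀ {K : Set} → (K → ℝ) → (K → ℕ) → ℕ → K → ℚ
term w d n k = seq (w k) n ℚ.* cast (d k)

seq-weightedSum : ∀ {K : Set} (w : K → ℝ) d ks n → seq (weightedSum w d ks) n ≡ sum (term w d n) ks
seq-weightedSum w d []       n = refl
seq-weightedSum w d (k ∷ ks) n = cong (term w d n k ℚ.+_) (seq-weightedSum w d ks n)

seq-partialCost : ∀ {I} (T : 2WCST I) ks n →
  seq (partialCost {I} T ks) n ≡ sum (term (Instance.weight I) (depth {I} T) n) ks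
seq-partialCost {I} T ks n = seq-weightedSum (Instance.weight I) (depth {I} T) ks n

weightedSum-≤ : ∀ {K : Set} (w : K → ℝ) d ks (w′ : K → ℝ) d′ ks′ →
  Eventually (λ n → sum (term w d n) ks ℚ.≤ sum (term w′ d′ n) ks′) →
  weightedSum w d ks ≤ weightedSum w′ d′ ks′
weightedSum-≤ w d ks w′ d′ ks′ (N , h) = eventually-≤ {weightedSum w d ks} {weightedSum w′ d′ ks′}
  (N , λ n p → subst₂ ℚ._≤_ (sym (seq-weightedSum w d ks n)) (sym (seq-weightedSum w′ d′ ks′ n)) (h n p))

seq-^ : ∀ x i n → seq (x ^ i) n ≡ seq x n ^ℚ i
seq-^ x zero    n = refl
seq-^ x (suc i) n = cong (seq x n ℚ.*_) (seq-^ x i n)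

-- The chain of equal-to tests

LeafAt-prefix : ∀ {K : Set} {t : Tree K} {k k′} a {b} → LeafAt t a k → LeafAt t (a ++ b) k′ → k ≡ k′
LeafAt-prefix [] {[]} (here p) (here q) with refl ← trans (sym p) q = refl
LeafAt-prefix [] {_ ∷ _} (here p) (there q _) with () ← trans (sym p) q
LeafAt-prefix (_ ∷ a) (there _ l) (there _ l′) = LeafAt-prefix a l l′

chainFrom : ∀ {K} → (ℕ → K) → ℕ → Tree K
chainFrom key n []          = test ⟨= key n ⟩
chainFrom key n (true ∷ _)  = leaf (key n)
chainFrom key n (false ∷ a) = chainFrom key (suc n) a

chainPath : ℕ → Address
chainPath zero    = true ∷ []
chainPath (suc i) = false ∷ chainPath i

length-chainPath : ∀ i → length (chainPath i) ≡ suc i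
length-chainPath zero    = refl
length-chainPath (suc i) = cong suc (length-chainPath i)

chain-leaf : ∀ {K} (key : ℕ → K) n i → LeafAt (chainFrom key n) (chainPath i) (key (n ℕ.+ i))
chain-leaf key n zero    = there refl (here (cong (leaf ∘ key) (sym (ℕ.+-identityʳ n))))
chain-leaf key n (suc i) = there refl
  (subst (LeafAt (chainFrom key (suc n)) (chainPath i) ∘ key) (sym (ℕ.+-suc n i)) (chain-leaf key (suc n) i))

chain-leaf⁻¹ : ∀ {K} {key : ℕ → K} {n a k} → LeafAt (chainFrom key n) a k →
  ∃[ i ] a ≡ chainPath i × k ≡ key (n ℕ.+ i)
chain-leaf⁻¹ {key = key} {n} (there {b = true} _ (here refl)) =
  0 , refl , cong key (sym (ℕ.+-identityʳ n))
chain-leaf⁻¹ {key = key} {n} (there {b = false} _ l) with i , refl , refl ← chain-leaf⁻¹ l =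
  suc i , refl , cong key (sym (ℕ.+-suc n i))

module Chain (I : Instance) (index : ℕ ↔ Instance.Key I) where
  open Instance I
  open Inverse index using () renaming (to to key; from to rank)

  key-rank : ∀ k → key (rank k) ≡ k
  key-rank = Inverse.strictlyInverseˡ index

  key-injective : ∀ {i j} → key i ≡ key j → i ≡ j
  key-injective {i} {j} e = trans (sym (Inverse.strictlyInverseʳ index i))
    (trans (cong rank e) (Inverse.strictlyInverseʳ index j))

  chain-search : ∀ n i → SearchEndsIn I (key (n ℕ.+ i)) (chainFrom key n) (key (n ℕ.+ i))
  chain-search n i = step refl (branch i)
    where
    branch : ∀ i → SearchEndsIn I (key (n ℕ.+ i))
      (child (chainFrom key n) (answer I (key (n ℕ.+ i)) ⟨= key n ⟩)) (key (n ℕ.+ i))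
    branch zero with key (n ℕ.+ 0) ≟ᴷ key n
    ... | yes e = stop (cong leaf (sym e))
    ... | no ¬e = contradiction (cong key (ℕ.+-identityʳ n)) ¬e
    branch (suc i) with key (n ℕ.+ suc i) ≟ᴷ key n
    ... | yes e = contradiction (ℕ.+-cancelˡ-≡ n (suc i) 0 (trans (key-injective e) (sym (ℕ.+-identityʳ n)))) λ ()
    ... | no  _ = subst (λ j → SearchEndsIn I (key j) (chainFrom key (suc n)) (key j))
      (sym (ℕ.+-suc n i)) (chain-search (suc n) i)

  chain : 2WCST I
  chain = record
    { tree     = chainFrom key 0
    ; leaf-of  = λ k → chainPath (rank k)
        , subst (LeafAt (chainFrom key 0) (chainPath (rank k))) (key-rank k) (chain-leaf key 0 (rank k))
        , λ l → unique (chain-leaf⁻¹ l)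
    ; searches = λ q → subst (λ k → SearchEndsIn I k (chainFrom key 0) k) (key-rank q) (chain-search 0 (rank q))
    }
    where
    unique : ∀ {a k} → ∃[ i ] a ≡ chainPath i × k ≡ key i → chainPath (rank k) ≡ a
    unique (i , refl , refl) = cong chainPath (Inverse.strictlyInverseʳ index i)

  depth-chain : ∀ k → depth chain k ≡ suc (rank k)
  depth-chain k = length-chainPath (rank k)

  covered : ∀ ks → ∃[ N ] ks ⊆ applyUpTo key N
  covered [] = 0 , λ ()
  covered (k ∷ ks) with N , ks⊆ ← covered ks = suc (rank k) ℕ.⊔ N , λ
    { (here refl) → subst (_∈ applyUpTo key (suc (rank k) ℕ.⊔ N)) (key-rank k)
        (∈-applyUpTo⁺ key (ℕ.m≤m⊔n (suc (rank k)) N))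
    ; (there k∈) → widen (ℕ.m≤n⊔m (suc (rank k)) N) (ks⊆ k∈) }
    where
    widen : ∀ {M N k} → M ℕ.≤ N → k ∈ applyUpTo key M → k ∈ applyUpTo key N
    widen M≤N k∈ with i , i<M , refl ← ∈-applyUpTo⁻ key k∈ = ∈-applyUpTo⁺ key (ℕ.<-≤-trans i<M M≤N)

  applyUpTo-unique : ∀ N → Unique (applyUpTo key N)
  applyUpTo-unique N = Unique.applyUpTo⁺₁ key N λ i<j _ e → ℕ.<⇒≢ i<j (key-injective e)

  -- Carries the lower bound for codes over to every tree, whatever tests it uses and whatever the
  -- order of the keys.
  leaf-PrefixFree : ∀ (T : 2WCST I) → PrefixFree (λ i → just (proj₁ (2WCST.leaf-of T (key i))))
  leaf-PrefixFree T {i} {j} {a} {b} ci cj = key-injective (LeafAt-prefix a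
    (subst (λ x → LeafAt (2WCST.tree T) x (key i)) (Maybe.just-injective ci) (proj₁ (proj₂ (2WCST.leaf-of T (key i)))))
    (subst (λ x → LeafAt (2WCST.tree T) x (key j)) (Maybe.just-injective cj) (proj₁ (proj₂ (2WCST.leaf-of T (key j))))))

-- Below the golden ratio

module BelowGolden {γ : ℝ} {I : Instance} (γ<γ₀ : γ < γ₀) (geometric : IsGeometric γ I) where
  open Instance I
  open IsGeometric geometric
  open Inverse index using () renaming (to to key; from to rank)
  open Chain I index

  power : Key → ℝ
  power k = γ ^ rank k

  weight≈power : ∀ k → weight k ≈ power k
  weight≈power k = subst (λ x → weight x ≈ power k) (key-rank k) (weight-index (rank k))

  -- The strict bounds on `γ` pass to its late rational approximants, so the theory of codes applies
  -- with each of them as `q`.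
  golden : Eventually λ n → 0ℚ ℚ.≤ seq γ n × seq γ n ℚ.+ seq γ n ℚ.* seq γ n ℚ.≤ 1ℚ
  golden =
    let δ , 0<δ , M , f = 0<γ
        ε , 0<ε , N , g = γ<γ₀
    in M ℕ.⊔ N , λ n p →
    let 0≤γₙ = ℚ.≤-trans (p≤p+ε 0<δ ℚ.≤-refl) (f n (ℕ.m⊔n≤o⇒m≤o M N p))
    in 0≤γₙ , below-γ₀ (seq γ n) n 0≤γₙ
      (ℚ.≤-trans (p≤p+ε 0<ε ℚ.≤-refl) (g n (ℕ.m⊔n≤o⇒n≤o M N p)))

  address : 2WCST I → ℕ → Address
  address T i = proj₁ (2WCST.leaf-of T (key i))

  term-key : ∀ (T : 2WCST I) n i {d} → depth {I} T (key i) ≡ d → term power (depth {I} T) n (key i) ≡ 1ℚ ℚ.* (seq γ n ^ℚ i ℚ.* cast d)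
  term-key T n i refl = trans
    (cong (ℚ._* cast (depth {I} T (key i)))
      (trans (seq-^ γ (rank (key i)) n) (cong (seq γ n ^ℚ_) (Inverse.strictlyInverseʳ index i))))
    (sym (ℚ.*-identityˡ (seq γ n ^ℚ i ℚ.* cast (depth {I} T (key i)))))

  0≤term : ∀ (T : 2WCST I) {n} → 0ℚ ℚ.≤ seq γ n → ∀ k → 0ℚ ℚ.≤ term power (depth {I} T) n k
  0≤term T {n} 0≤q k =
    subst (0ℚ ℚ.≤_) (sym (seq-^ γ (rank k) n)) (0≤q^n 0≤q (rank k)) ⊗ 0≤cast (depth {I} T k)

  sum-power-term : ∀ (T : 2WCST I) n {d : ℕ → ℕ} → (∀ i → depth {I} T (key i) ≡ d i) → ∀ N →
    sum (term power (depth {I} T) n) (applyUpTo key N) ≡ 1ℚ ℚ.* horner (seq γ n) (cast ∘ d) N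
  sum-power-term T n {d} eq = sum-applyUpTo {f = term power (depth {I} T) n} {g = key} {h = cast ∘ d} 1ℚ (λ i → term-key T n i (eq i))

  module _ (T₀ : 2WCST I) (linear : ∀ i → depth {I} T₀ (key i) ≡ suc i) where

    linear-≤ : ∀ (T : 2WCST I) n → 0ℚ ℚ.≤ seq γ n → seq γ n ℚ.+ seq γ n ℚ.* seq γ n ℚ.≤ 1ℚ →
      ∀ N ks → Unique ks → ks ⊆ applyUpTo key N →
      sum (term power (depth {I} T₀) n) ks ℚ.≤ sum (term power (depth {I} T) n) (applyUpTo key (suc N))
    linear-≤ T n 0≤q q+q²≤1 N ks u ks⊆ = begin
      sum (term power (depth {I} T₀) n) ks
        ≤⟨ sum-⊆ {f = term power (depth {I} T₀) n} (0≤term T₀ {n} 0≤q) u ks⊆ ⟩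
      sum (term power (depth {I} T₀) n) (applyUpTo key N)
        ≡⟨ sum-power-term T₀ n {suc} linear N ⟩
      1ℚ ℚ.* horner (seq γ n) (cast ∘ suc) N
        ≤⟨ ℚ.*-monoˡ-≤-nonNeg 1ℚ (CodeCost.linear-optimal (seq γ n) 0≤q q+q²≤1 (address T) (leaf-PrefixFree T) N) ⟩
      1ℚ ℚ.* horner (seq γ n) (cast ∘ length ∘ address T) (suc N)
        ≡⟨ sym (sum-power-term T n {length ∘ address T} (λ i → refl) (suc N)) ⟩
      sum (term power (depth {I} T) n) (applyUpTo key (suc N)) ∎
      where
      open ℚ.≤-Reasoning

    -- A finite set of keys lies among the first `N`. Its cost in `T₀` is at most that of the first
    -- `suc N` keys in `T`, itself a partial cost bounded by `c`; weights become powers before this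
    -- comparison and weights again after it.
    linear-depth⇒optimal : IsOptimal T₀
    linear-depth⇒optimal T c T≤c ks u =
      ≤ℝ-trans {partialCost T₀ ks} {weightedSum power (depth {I} T₀) ks} {c}
        (weightedSum-mono {w = weight} {power} (depth {I} T₀) (λ k → proj₁ (weight≈power k)) ks)
      (≤ℝ-trans {weightedSum power (depth {I} T₀) ks} {weightedSum power (depth {I} T) ys} {c}
        (weightedSum-≤ power (depth {I} T₀) ks power (depth {I} T) ys
          (proj₁ golden , λ n p → linear-≤ T n (proj₁ (proj₂ golden n p)) (proj₂ (proj₂ golden n p)) N ks u ks⊆))
      (≤ℝ-trans {weightedSum power (depth {I} T) ys} {partialCost T ys} {c}
        (weightedSum-mono {w = power} {weight} (depth {I} T) (λ k → proj₂ (weight≈power k)) ys)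
        (T≤c ys (applyUpTo-unique (suc N)))))
      where
      N   = proj₁ (covered ks)
      ks⊆ = proj₂ (covered ks)
      ys  = applyUpTo key (suc N)

lower-half : EqualToRootsBelow γ₀
lower-half γ 0<γ γ<γ₀ I geometric =
  Chain.chain I index , BelowGolden.linear-depth⇒optimal γ<γ₀ geometric (Chain.chain I index) linear , Inverse.to index 0 , refl
  where
  open IsGeometric geometric using (index)
  linear : ∀ i → depth (Chain.chain I index) (Inverse.to index i) ≡ suc i
  linear i = trans (Chain.depth-chain I index (Inverse.to index i)) (cong suc (Inverse.strictlyInverseʳ index i))

-- Above the golden ratio

-- The order isomorphism from ℕ to ℕ ∖ {k}, and its inverse (extended to k).
skip : ℕ → ℕ → ℕ
skip zero    j       = suc j
skip (suc k) zero    = zero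
skip (suc k) (suc j) = suc (skip k j)

collapse : ℕ → ℕ → ℕ
collapse k       zero    = zero
collapse zero    (suc j) = j
collapse (suc k) (suc j) = suc (collapse k j)

collapse-skip : ∀ k j → collapse k (skip k j) ≡ j
collapse-skip zero    j       = refl
collapse-skip (suc k) zero    = refl
collapse-skip (suc k) (suc j) = cong suc (collapse-skip k j)

skip-collapse : ∀ k j → j ≢ k → skip k (collapse k j) ≡ j
skip-collapse zero    zero    j≢k = contradiction refl j≢k
skip-collapse zero    (suc j) j≢k = refl
skip-collapse (suc k) zero    j≢k = refl
skip-collapse (suc k) (suc j) j≢k = cong suc (skip-collapse k j (j≢k ∘ cong suc))

skip≢ : ∀ k j → skip k j ≢ k
skip≢ (suc k) (suc j) e = skip≢ k j (ℕ.suc-injective e)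

skip-injective : ∀ k {i j} → skip k i ≡ skip k j → i ≡ j
skip-injective k {i} {j} e = trans (sym (collapse-skip k i)) (trans (cong (collapse k) e) (collapse-skip k j))

-- Valid at `j = k` too, where the new number `k` belongs to the successor of the removed key; so
-- less-than tests need no special case.
<-collapse : ∀ k q j → q ℕ.< collapse k j ⇔ skip k q ℕ.< j
<-collapse zero    q       zero    = mk⇔ (λ ()) (λ ())
<-collapse zero    q       (suc j) = mk⇔ s≤s ℕ.≤-pred
<-collapse (suc k) q       zero    = mk⇔ (λ ()) (λ ())
<-collapse (suc k) zero    (suc j) = mk⇔ (λ _ → s≤s z≤n) (λ _ → s≤s z≤n)
<-collapse (suc k) (suc q) (suc j) = mk⇔
  (s≤s ∘ Equivalence.to (<-collapse k q j) ∘ ℕ.≤-pred)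
  (s≤s ∘ Equivalence.from (<-collapse k q j) ∘ ℕ.≤-pred)

≡-collapse : ∀ k q j → j ≢ k → q ≡ collapse k j ⇔ skip k q ≡ j
≡-collapse k q j j≢k = mk⇔
  (λ e → trans (cong (skip k) e) (skip-collapse k j j≢k))
  (λ e → trans (sym (collapse-skip k q)) (cong (collapse k) e))

SearchEndsIn⇒LeafAt : ∀ {I : Instance} {q t k} → SearchEndsIn I q t k → ∃[ a ] LeafAt t a k
SearchEndsIn⇒LeafAt (stop e) = [] , here e
SearchEndsIn⇒LeafAt {I} (step {τ} e s) with a , l ← SearchEndsIn⇒LeafAt {I} s = _ , there e l

<⇒≱ : ∀ {p q} → p ℚ.< q → ¬ q ℚ.≤ p
<⇒≱ p<q q≤p = ℚ.<-irrefl refl (ℚ.<-≤-trans p<q q≤p)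

≤-limit : ∀ {p q} → (∀ ε → 0ℚ ℚ.< ε → p ℚ.≤ q ℚ.+ ε) → p ℚ.≤ q
≤-limit {p} {q} h = ℚ.≮⇒≥ λ q<p →
  let η   = p ℚ.- q
      0<η = p<q⇒0<q-p q<p
  in <⇒≱ (<-by (0<p*q 0<η 0<½) (cert p q)) (h (η ℚ.* ½) (0<p*q 0<η 0<½))
  where
  cert : ∀ p q → p ℚ.- (q ℚ.+ (p ℚ.- q) ℚ.* ½) ≡ (p ℚ.- q) ℚ.* ½
  cert = solve-∀ ℚ-ring

weightedTerm : ∀ {K : Set} → (K → ℚ) → (K → ℕ) → K → ℚ
weightedTerm v d k = v k ℚ.* cast (d k)

-- Costs for rational weights

module RationalWeights (I : Instance) (v : Instance.Key I → ℚ)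
  (weight≡v : ∀ k n → seq (Instance.weight I k) n ≡ v k) where

  -- `CostAtMost` for a rational bound, freed from the `ε` of the real order; possible because the
  -- weights are constant sequences.
  Bounded : 2WCST I → ℚ → Set
  Bounded T c = ∀ ks → Unique ks → sum (weightedTerm v (depth {I} T)) ks ℚ.≤ c

  sum-term : ∀ d ks n → sum (term (Instance.weight I) d n) ks ≡ sum (weightedTerm v d) ks
  sum-term d []       n = refl
  sum-term d (k ∷ ks) n = cong₂ ℚ._+_ (cong (ℚ._* cast (d k)) (weight≡v k n)) (sum-term d ks n)

  seq-cost : ∀ (T : 2WCST I) ks n → seq (partialCost {I} T ks) n ≡ sum (weightedTerm v (depth {I} T)) ks
  seq-cost T ks n = trans (seq-partialCost {I} T ks n) (sum-term (depth {I} T) ks n)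

  Bounded⇒CostAtMost : ∀ (T : 2WCST I) {c} → Bounded T c → CostAtMost {I} T (fromℚ c)
  Bounded⇒CostAtMost T {c} b ks u = eventually-≤ {partialCost {I} T ks} {fromℚ c}
    (0 , λ n _ → subst (ℚ._≤ c) (sym (seq-cost T ks n)) (b ks u))

  CostAtMost⇒Bounded : ∀ (T : 2WCST I) {c} → CostAtMost {I} T (fromℚ c) → Bounded T c
  CostAtMost⇒Bounded T {c} b ks u = ≤-limit λ ε 0<ε →
    let N , f = b ks u ε 0<ε
    in subst (ℚ._≤ c ℚ.+ ε) (seq-cost T ks N) (f N ℕ.≤-refl)

  optimal⇒Bounded : ∀ (T : 2WCST I) → IsOptimal {I} T → ∀ T′ {c} → Bounded T′ c → Bounded T c
  optimal⇒Bounded T optimal T′ {c} b = CostAtMost⇒Bounded T {c} (optimal T′ (fromℚ c) (Bounded⇒CostAtMost T′ {c} b))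

sum-map : ∀ {A B : Set} (f : B → ℚ) (g : A → B) xs → sum f (map g xs) ≡ sum (f ∘ g) xs
sum-map f g []       = refl
sum-map f g (x ∷ xs) = cong (f (g x) ℚ.+_) (sum-map f g xs)

sum-* : ∀ {A : Set} c (f : A → ℚ) xs → sum (λ x → c ℚ.* f x) xs ≡ c ℚ.* sum f xs
sum-* c f []       = sym (ℚ.*-zeroʳ c)
sum-* c f (x ∷ xs) = trans (cong (c ℚ.* f x ℚ.+_) (sum-* c f xs)) (sym (ℚ.*-distribˡ-+ c (f x) (sum f xs)))

sum-+ : ∀ {A : Set} {f g h : A → ℚ} → (∀ x → h x ≡ f x ℚ.+ g x) → ∀ xs → sum h xs ≡ sum f xs ℚ.+ sum g xs
sum-+ eq []       = refl
sum-+ {f = f} {g} eq (x ∷ xs) =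
  trans (cong₂ ℚ._+_ (eq x) (sum-+ eq xs)) (regroup (f x) (g x) (sum f xs) (sum g xs))
  where
  regroup : ∀ a b c d → (a ℚ.+ b) ℚ.+ (c ℚ.+ d) ≡ (a ℚ.+ c) ℚ.+ (b ℚ.+ d)
  regroup = solve-∀ ℚ-ring

-- Geometric series with a rational ratio

module Ratio (g : ℚ) (0<g : 0ℚ ℚ.< g) (g≤¾ : g ℚ.≤ ½ ℚ.+ ½ ℚ.* ½) where

  0≤g : 0ℚ ℚ.≤ g
  0≤g = ℚ.<⇒≤ 0<g

  0<1-g : 0ℚ ℚ.< 1ℚ ℚ.- g
  0<1-g = ℚ.<-≤-trans (0<p*q 0<½ 0<½) (≤-by (p≤q⇒0≤q-p g≤¾) (cert g))
    where
    cert : ∀ g → (1ℚ ℚ.- g) ℚ.- ½ ℚ.* ½ ≡ (½ ℚ.+ ½ ℚ.* ½) ℚ.- g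
    cert = solve-∀ ℚ-ring

  private instance
    g-pos : ℚ.Positive g
    g-pos = ℚ.positive 0<g
    g-nonZero : ℚ.NonZero g
    g-nonZero = ℚ.pos⇒nonZero g
    1-g-pos : ℚ.Positive (1ℚ ℚ.- g)
    1-g-pos = ℚ.positive 0<1-g
    1-g-nonZero : ℚ.NonZero (1ℚ ℚ.- g)
    1-g-nonZero = ℚ.pos⇒nonZero (1ℚ ℚ.- g)

  opaque
    -- The total weight of all keys.
    W : ℚ
    W = ℚ.1/ (1ℚ ℚ.- g)

    0<W : 0ℚ ℚ.< W
    0<W = ℚ.positive⁻¹ W {{ℚ.1/pos⇒pos (1ℚ ℚ.- g)}}

    W-unfold : W ≡ 1ℚ ℚ.+ g ℚ.* W
    W-unfold = trans (split g W) (cong (ℚ._+ g ℚ.* W) (ℚ.*-inverseʳ (1ℚ ℚ.- g)))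
      where
      split : ∀ g w → w ≡ (1ℚ ℚ.- g) ℚ.* w ℚ.+ g ℚ.* w
      split = solve-∀ ℚ-ring

    h : ℚ
    h = ℚ.1/ g

    g*h≡1 : g ℚ.* h ≡ 1ℚ
    g*h≡1 = ℚ.*-inverseʳ g

  0≤W : 0ℚ ℚ.≤ W
  0≤W = ℚ.<⇒≤ 0<W

  -- The difference is in fact 0. In this form, multiples of the equation for `W` can enter a
  -- certificate.
  0≤W-1-gW : 0ℚ ℚ.≤ W ℚ.- (1ℚ ℚ.+ g ℚ.* W)
  0≤W-1-gW = p≤q⇒0≤q-p (ℚ.≤-reflexive (sym W-unfold))

  0≤gⁿ : ∀ n → 0ℚ ℚ.≤ g ^ℚ n
  0≤gⁿ = 0≤q^n 0≤g

  -- Going from `n` to `suc n` multiplies by `g(4 + n)/(3 + n)`, and three quarters of `4 + n` are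
  -- at most `3 + n`. This is an explicit rate for `gⁿ→0`.
  [3+n]gⁿ≤3 : ∀ n → (cast 3 ℚ.+ cast n) ℚ.* g ^ℚ n ℚ.≤ cast 3
  [3+n]gⁿ≤3 zero    = ℚ.≤-refl
  [3+n]gⁿ≤3 (suc n) = subst (λ c → (cast 3 ℚ.+ c) ℚ.* g ^ℚ suc n ℚ.≤ cast 3) (sym (cast-suc n))
    (≤-by (p≤q⇒0≤q-p ([3+n]gⁿ≤3 n) ⊕ ((0≤cast 4 ⊕ 0≤cast n) ⊗ p≤q⇒0≤q-p g≤¾ ⊕ 0≤cast n ⊗ (0≤½ ⊗ 0≤½)) ⊗ 0≤gⁿ n)
      (cert g (cast n) (g ^ℚ n)))
    where
    0≤½ = ℚ.<⇒≤ 0<½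
    cert : ∀ g n x → cast 3 ℚ.- (cast 3 ℚ.+ (1ℚ ℚ.+ n)) ℚ.* (g ℚ.* x) ≡
      (cast 3 ℚ.- (cast 3 ℚ.+ n) ℚ.* x) ℚ.+
      ((cast 4 ℚ.+ n) ℚ.* ((½ ℚ.+ ½ ℚ.* ½) ℚ.- g) ℚ.+ n ℚ.* (½ ℚ.* ½)) ℚ.* x
    cert = solve-∀ ℚ-ring

  gⁿ→0 : ∀ {ε} → 0ℚ ℚ.< ε → Eventually λ n → g ^ℚ n ℚ.≤ ε
  gⁿ→0 {ε} 0<ε with N , f ← 1/N≤ε (ε ℚ.* (+ 1 ℚ./ 3)) (0<p*q 0<ε (ℚ.positive⁻¹ (+ 1 ℚ./ 3)))
    = N , λ n N≤n → ℚ.*-cancelˡ-≤-pos (cast 3 ℚ.+ cast n) {{ℚ.positive (0<3+n n)}}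
      (ℚ.≤-trans ([3+n]gⁿ≤3 n)
        (≤-by (0≤cast 3 ⊗ (0≤cast (suc n) ⊗ p≤q⇒0≤q-p (f n N≤n)) ⊕ 0≤cast 2 ⊗ ℚ.<⇒≤ 0<ε)
          (eq n)))
    where
    0<3+n : ∀ n → 0ℚ ℚ.< cast 3 ℚ.+ cast n
    0<3+n n = subst (0ℚ ℚ.<_) (cast-+ 3 n) (0<cast-suc (2 ℕ.+ n))
    cert : ∀ n ε r → (cast 3 ℚ.+ n) ℚ.* ε ℚ.- cast 3 ℚ.* (r ℚ.* (1ℚ ℚ.+ n)) ≡
      cast 3 ℚ.* ((1ℚ ℚ.+ n) ℚ.* (ε ℚ.* (+ 1 ℚ./ 3) ℚ.- r)) ℚ.+ cast 2 ℚ.* ε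
    cert = solve-∀ ℚ-ring
    eq : ∀ n → (cast 3 ℚ.+ cast n) ℚ.* ε ℚ.- cast 3 ≡
      cast 3 ℚ.* (cast (suc n) ℚ.* (ε ℚ.* (+ 1 ℚ./ 3) ℚ.- + 1 ℚ./ suc n)) ℚ.+ cast 2 ℚ.* ε
    eq n = trans
      (cong (λ x → (cast 3 ℚ.+ cast n) ℚ.* ε ℚ.- cast 3 ℚ.* x)
        (sym (trans (cong (+ 1 ℚ./ suc n ℚ.*_) (sym (cast-suc n))) (/-*-cast 1 n))))
      (trans (cert (cast n) ε (+ 1 ℚ./ suc n))
        (cong (λ m → cast 3 ℚ.* (m ℚ.* (ε ℚ.* (+ 1 ℚ./ 3) ℚ.- + 1 ℚ./ suc n)) ℚ.+ cast 2 ℚ.* ε) (sym (cast-suc n))))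

  ≤gⁿ*c⇒≤0 : ∀ {x c} → 0ℚ ℚ.≤ c → Eventually (λ n → x ℚ.≤ g ^ℚ n ℚ.* c) → x ℚ.≤ 0ℚ
  ≤gⁿ*c⇒≤0 {x} {c} 0≤c (N , f) = ≤-limit λ ε 0<ε →
    let δ = ε ℚ.* i
        M , k = gⁿ→0 {δ} (0<p*q 0<ε 0<i)
        n = N ℕ.⊔ M
    in ≤-by (p≤q⇒0≤q-p (f n (ℕ.m≤m⊔n N M)) ⊕ p≤q⇒0≤q-p (k n (ℕ.m≤n⊔m N M)) ⊗ 0≤c ⊕ ℚ.<⇒≤ (0<p*q 0<ε 0<i))
      (trans (cong (λ y → (0ℚ ℚ.+ y) ℚ.- x) (trans (sym (ℚ.*-identityʳ ε)) (cong (ε ℚ.*_) (sym (ℚ.*-inverseˡ (1ℚ ℚ.+ c))))))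
        (cert ε i c x (g ^ℚ n)))
    where
    0<1+c : 0ℚ ℚ.< 1ℚ ℚ.+ c
    0<1+c = ℚ.+-mono-<-≤ (ℚ.positive⁻¹ 1ℚ) 0≤c
    instance
      1+c-pos : ℚ.Positive (1ℚ ℚ.+ c)
      1+c-pos = ℚ.positive 0<1+c
      1+c-nonZero : ℚ.NonZero (1ℚ ℚ.+ c)
      1+c-nonZero = ℚ.pos⇒nonZero (1ℚ ℚ.+ c)
    i = ℚ.1/ (1ℚ ℚ.+ c)
    0<i : 0ℚ ℚ.< i
    0<i = ℚ.positive⁻¹ i {{ℚ.1/pos⇒pos (1ℚ ℚ.+ c)}}
    cert : ∀ ε i c x y → (0ℚ ℚ.+ ε ℚ.* (i ℚ.* (1ℚ ℚ.+ c))) ℚ.- x ≡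
      (y ℚ.* c ℚ.- x) ℚ.+ (ε ℚ.* i ℚ.- y) ℚ.* c ℚ.+ ε ℚ.* i
    cert = solve-∀ ℚ-ring

  0≤weightedTerm : ∀ d i → 0ℚ ℚ.≤ weightedTerm (g ^ℚ_) d i
  0≤weightedTerm d i = 0≤gⁿ i ⊗ 0≤cast (d i)

  sum-weightedTerm : ∀ d N → sum (weightedTerm (g ^ℚ_) d) (applyUpTo id N) ≡ horner g (cast ∘ d) N
  sum-weightedTerm d N = trans
    (sum-applyUpTo {g = id} {h = cast ∘ d} 1ℚ (λ i → sym (ℚ.*-identityˡ (weightedTerm (g ^ℚ_) d i))) N)
    (ℚ.*-identityˡ (horner g (cast ∘ d) N))

  -- Σ_{i≥0} gⁱ (a + i) = a W + g W².
  horner-arithmetic : ∀ {a f} → 0ℚ ℚ.≤ a → (∀ i → f i ≡ a ℚ.+ cast i) → ∀ n →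
    horner g f n ℚ.≤ a ℚ.* W ℚ.+ g ℚ.* (W ℚ.* W)
  horner-arithmetic 0≤a eq zero = 0≤a ⊗ 0≤W ⊕ 0≤g ⊗ (0≤W ⊗ 0≤W)
  horner-arithmetic {a} {f} 0≤a eq (suc n) =
    subst (λ x → x ℚ.+ g ℚ.* horner g (f ∘ suc) n ℚ.≤ a ℚ.* W ℚ.+ g ℚ.* (W ℚ.* W))
      (sym (trans (eq 0) (ℚ.+-identityʳ a)))
      (≤-by (0≤g ⊗ p≤q⇒0≤q-p (horner-arithmetic {1ℚ ℚ.+ a} (0≤1 ⊕ 0≤a) eq′ n) ⊕ (0≤a ⊕ 0≤g ⊗ 0≤W) ⊗ 0≤W-1-gW)
        (cert a g W (horner g (f ∘ suc) n)))
    where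
    shift : ∀ a i → a ℚ.+ (1ℚ ℚ.+ i) ≡ (1ℚ ℚ.+ a) ℚ.+ i
    shift = solve-∀ ℚ-ring
    eq′ : ∀ i → f (suc i) ≡ (1ℚ ℚ.+ a) ℚ.+ cast i
    eq′ i = trans (eq (suc i)) (trans (cong (a ℚ.+_) (cast-suc i)) (shift a (cast i)))
    cert : ∀ a g w x → (a ℚ.* w ℚ.+ g ℚ.* (w ℚ.* w)) ℚ.- (a ℚ.+ g ℚ.* x) ≡
      g ℚ.* (((1ℚ ℚ.+ a) ℚ.* w ℚ.+ g ℚ.* (w ℚ.* w)) ℚ.- x) ℚ.+ (a ℚ.+ g ℚ.* w) ℚ.* (w ℚ.- (1ℚ ℚ.+ g ℚ.* w))
    cert = solve-∀ ℚ-ring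

  -- Keys in the order of decreasing weight

  power : ℕ → ℝ
  power i = fromℚ g ^ i

  0≤power : ∀ i → 0ℝ ≤ power i
  0≤power i = eventually-≤ {0ℝ} {power i} (0 , λ n _ → subst (0ℚ ℚ.≤_) (sym (seq-^ (fromℚ g) i n)) (0≤gⁿ i))

  natural : Instance
  natural = record
    { Key = ℕ ; _≺_ = ℕ._<_ ; isStrictTotalOrder = ℕ.<-isStrictTotalOrder
    ; weight = power ; weight≥0 = 0≤power }

  open Instance natural using (_≟ᴷ_; _≺?_)

  splitTree : Tree ℕ
  splitTree []                 = test ⟨< 2 ⟩
  splitTree (true ∷ [])        = test ⟨= 0 ⟩
  splitTree (true ∷ true ∷ _)  = leaf 0
  splitTree (true ∷ false ∷ _) = leaf 1
  splitTree (false ∷ a)        = chainFrom id 2 a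

  splitPath : ℕ → Address
  splitPath 0             = true ∷ true ∷ []
  splitPath 1             = true ∷ false ∷ []
  splitPath (suc (suc i)) = false ∷ chainPath i

  split-leaf : ∀ k → LeafAt splitTree (splitPath k) k
  split-leaf 0             = there refl (there refl (here refl))
  split-leaf 1             = there refl (there refl (here refl))
  split-leaf (suc (suc i)) = there refl (chain-leaf id 2 i)

  split-leaf⁻¹ : ∀ {a k} → LeafAt splitTree a k → splitPath k ≡ a
  split-leaf⁻¹ (there {b = true} _ (there {b = true} _ (here refl)))  = refl
  split-leaf⁻¹ (there {b = true} _ (there {b = false} _ (here refl))) = refl
  split-leaf⁻¹ (there {b = false} _ l) with i , refl , refl ← chain-leaf⁻¹ l = refl

  -- Takes the answer as an equation, so that `dec-true`, `dec-false` or `relabel-answer` can supply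
  -- it.
  branch : ∀ {q t τ b k} → t [] ≡ test τ → answer natural q τ ≡ b →
    SearchEndsIn natural q (child t b) k → SearchEndsIn natural q t k
  branch e refl s = step e s

  split-search : ∀ q → SearchEndsIn natural q splitTree q
  split-search 0 = branch refl (dec-true (0 ≺? 2) (s≤s z≤n)) (branch refl (dec-true (0 ≟ᴷ 0) refl) (stop refl))
  split-search 1 = branch refl (dec-true (1 ≺? 2) (s≤s (s≤s z≤n))) (branch refl (dec-false (1 ≟ᴷ 0) λ ()) (stop refl))
  split-search (suc (suc i)) = branch refl (dec-false (suc (suc i) ≺? 2) λ { (s≤s (s≤s ())) })
    (Chain.chain-search natural (↔-id ℕ) 2 i)

  split : 2WCST natural
  split = record
    { tree = splitTree ; leaf-of = λ k → splitPath k , split-leaf k , split-leaf⁻¹ ; searches = split-search }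

  -- Removing the key tested at the root

  relabelTest : ℕ → Test ℕ → Test ℕ
  relabelTest k ⟨< j ⟩ = ⟨< collapse k j ⟩
  relabelTest k ⟨= j ⟩ with j ℕ.≟ k
  -- Without the key k the test ⟨= k ⟩ always answers "no", like ⟨< 0 ⟩.
  ... | yes _ = ⟨< 0 ⟩
  ... | no  _ = ⟨= collapse k j ⟩

  relabelNode : ℕ → Node ℕ → Node ℕ
  relabelNode k (leaf j) = leaf (collapse k j)
  relabelNode k (test τ) = test (relabelTest k τ)

  relabel : ℕ → Tree ℕ → Tree ℕ
  relabel k t = relabelNode k ∘ t

  relabel-answer : ∀ k q τ → answer natural q (relabelTest k τ) ≡ answer natural (skip k q) τ
  relabel-answer k q ⟨< j ⟩ = does-⇔ (<-collapse k q j) (q ≺? collapse k j) (skip k q ≺? j)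
  relabel-answer k q ⟨= j ⟩ with j ℕ.≟ k
  ... | yes refl = trans (dec-false (q ≺? 0) λ ()) (sym (dec-false (skip k q ≟ᴷ k) (skip≢ k q)))
  ... | no  j≢k  = does-⇔ (≡-collapse k q j j≢k) (q ≟ᴷ collapse k j) (skip k q ≟ᴷ j)

  relabel-search : ∀ k {q t} → SearchEndsIn natural (skip k q) t (skip k q) → SearchEndsIn natural q (relabel k t) q
  relabel-search k {q} (stop e) = stop (trans (cong (relabelNode k) e) (cong leaf (collapse-skip k q)))
  relabel-search k {q} (step {τ} e s) =
    branch (cong (relabelNode k) e) (relabel-answer k q τ) (relabel-search k s)

  relabelNode-leaf : ∀ k {j} n → relabelNode k n ≡ leaf j → n ≡ leaf (skip k j) ⊎ n ≡ leaf k
  relabelNode-leaf k (leaf i) refl with i ℕ.≟ k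
  ... | yes refl = inj₂ refl
  ... | no  i≢k  = inj₁ (cong leaf (sym (skip-collapse k i i≢k)))

  relabelNode-test : ∀ k {τ} n → relabelNode k n ≡ test τ → ∃[ τ′ ] n ≡ test τ′
  relabelNode-test k (test τ′) refl = τ′ , refl

  -- The second alternative is needed because `collapse k` identifies `k` with its successor.
  -- `k-not-below-no` excludes it later.
  relabel-leaf⁻¹ : ∀ k {t a j} → LeafAt (relabel k t) a j → LeafAt t a (skip k j) ⊎ LeafAt t a k
  relabel-leaf⁻¹ k {t} (here e) = Sum.map here here (relabelNode-leaf k (t []) e)
  relabel-leaf⁻¹ k {t} (there e l) with _ , e′ ← relabelNode-test k (t []) e =
    Sum.map (there e′) (there e′) (relabel-leaf⁻¹ k l)

  module Removal (T : 2WCST natural) (k : ℕ) (root : 2WCST.tree T [] ≡ test ⟨= k ⟩) where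
    open 2WCST T

    address : ℕ → Address
    address j = proj₁ (leaf-of j)

    unique : ∀ {a j} → LeafAt tree a j → address j ≡ a
    unique {j = j} = proj₂ (proj₂ (leaf-of j))

    search-below : ∀ q → SearchEndsIn natural q (child tree (does (q ≟ᴷ k))) q
    search-below q with searches q
    ... | stop e = contradiction (trans (sym root) e) λ ()
    ... | step e s with refl ← trans (sym root) e = s

    search-no : ∀ {q} → q ≢ k → SearchEndsIn natural q (child tree false) q
    search-no {q} q≢k = subst (λ b → SearchEndsIn natural q (child tree b) q)
      (dec-false (q ≟ᴷ k) q≢k) (search-below q)

    search-yes : SearchEndsIn natural k (child tree true) k
    search-yes = subst (λ b → SearchEndsIn natural k (child tree b) k)
      (dec-true (k ≟ᴷ k) refl) (search-below k)

    -- The search for `k` ends on the other side of the root, and `k` has only one leaf.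
    k-not-below-no : ∀ {a} → ¬ LeafAt (child tree false) a k
    k-not-below-no l with _ , l′ ← SearchEndsIn⇒LeafAt {natural} search-yes
      with () ← trans (sym (unique (there root l′))) (unique (there root l))

    below-no : ∀ {a j} → LeafAt (relabel k (child tree false)) a j → address (skip k j) ≡ false ∷ a
    below-no l with relabel-leaf⁻¹ k l
    ... | inj₁ l′ = unique (there root l′)
    ... | inj₂ l′ = contradiction l′ k-not-below-no

    search-removed : ∀ q → SearchEndsIn natural q (relabel k (child tree false)) q
    search-removed q = relabel-search k (search-no (skip≢ k q))

    removed : 2WCST natural
    removed = record
      { tree     = relabel k (child tree false)
      ; leaf-of  = leaf-of′
      ; searches = search-removed
      }
      where
      leaf-of′ : ∀ j → ∃! _≡_ λ a → LeafAt (relabel k (child tree false)) a j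
      leaf-of′ j with a , l ← SearchEndsIn⇒LeafAt {natural} (search-removed j) =
        a , l , λ l′ → List.∷-injectiveʳ (trans (sym (below-no l)) (below-no l′))

    depth-removed : ∀ j → depth {natural} T (skip k j) ≡ suc (depth {natural} removed j)
    depth-removed j = cong length (below-no (proj₁ (proj₂ (2WCST.leaf-of removed j))))

    depth-pred : ∀ j → depth {natural} T j ≡ suc (ℕ.pred (depth {natural} T j))
    depth-pred j with address j | proj₁ (proj₂ (leaf-of j))
    ... | []    | here e = contradiction (trans (sym root) e) λ ()
    ... | _ ∷ _ | _      = refl

  g-geometric : IsGeometric (fromℚ g) natural
  g-geometric = record
    { 0<γ = g , 0<g , 0 , λ _ _ → ℚ.≤-reflexive (ℚ.+-identityˡ g)
    ; γ<1 = ½ ℚ.* ½ , 0<p*q 0<½ 0<½ , 0 , λ _ _ → ≤-by (p≤q⇒0≤q-p g≤¾) (cert g)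
    ; index = ↔-id ℕ
    ; weight-index = λ i → refl-≤ i , refl-≤ i
    }
    where
    cert : ∀ g → 1ℚ ℚ.- (g ℚ.+ ½ ℚ.* ½) ≡ (½ ℚ.+ ½ ℚ.* ½) ℚ.- g
    cert = solve-∀ ℚ-ring
    refl-≤ : ∀ i → power i ≤ power i
    refl-≤ i = eventually-≤ {power i} {power i} (0 , λ _ _ → ℚ.≤-refl)

  open RationalWeights natural (g ^ℚ_) (λ k n → seq-^ (fromℚ g) k n)

  -- Costs of the split tree and after a removal

  g*gʲ≤g^skip : ∀ k j → g ℚ.* g ^ℚ j ℚ.≤ g ^ℚ skip k j
  g*gʲ≤g^skip zero    j       = ℚ.≤-refl
  g*gʲ≤g^skip (suc k) zero    = ≤-by (ℚ.<⇒≤ 0<1-g) (cong (λ x → 1ℚ ℚ.- x) (ℚ.*-identityʳ g))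
  g*gʲ≤g^skip (suc k) (suc j) = ℚ.*-monoˡ-≤-nonNeg g {{ℚ.pos⇒nonNeg g}} (g*gʲ≤g^skip k j)

  W-partial : ∀ N → W ≡ horner g (λ _ → 1ℚ) N ℚ.+ g ^ℚ N ℚ.* W
  W-partial zero = sym (trans (ℚ.+-identityˡ (1ℚ ℚ.* W)) (ℚ.*-identityˡ W))
  W-partial (suc N) = trans W-unfold
    (trans (cong (λ w → 1ℚ ℚ.+ g ℚ.* w) (W-partial N)) (regroup g (horner g (λ _ → 1ℚ) N) (g ^ℚ N) W))
    where
    regroup : ∀ g x y w → 1ℚ ℚ.+ g ℚ.* (x ℚ.+ y ℚ.* w) ≡ (1ℚ ℚ.+ g ℚ.* x) ℚ.+ (g ℚ.* y) ℚ.* w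
    regroup = solve-∀ ℚ-ring

  sum-pow : ∀ N → sum (λ i → g ^ℚ i ℚ.* 1ℚ) (applyUpTo id N) ≡ horner g (λ _ → 1ℚ) N
  sum-pow N = trans
    (sum-applyUpTo {g = id} {h = λ _ → 1ℚ} 1ℚ (λ i → sym (ℚ.*-identityˡ (g ^ℚ i ℚ.* 1ℚ))) N)
    (ℚ.*-identityˡ (horner g (λ _ → 1ℚ) N))

  module _ (1<g+g² : 1ℚ ℚ.< g ℚ.+ g ℚ.* g) where

    -- The split tree is cheaper than the chain, which costs W², by this amount.
    opaque
      gain : ℚ
      gain = (g ℚ.+ g ℚ.* g ℚ.- 1ℚ) ℚ.* W

      gain-unfold : gain ≡ (g ℚ.+ g ℚ.* g ℚ.- 1ℚ) ℚ.* W
      gain-unfold = refl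

      0<gain : 0ℚ ℚ.< gain
      0<gain = 0<p*q (p<q⇒0<q-p 1<g+g²) 0<W

    depth-split : ∀ i → depth {natural} split (suc (suc i)) ≡ suc (suc i)
    depth-split i = cong suc (length-chainPath i)

    -- Compared with the chain, key 0 is one level lower, key 1 stays and all others are one level
    -- higher. The net saving `g² W - 1` equals `(g + g² - 1) W`.
    split-bounded : Bounded split (W ℚ.* W ℚ.- gain)
    split-bounded ks u = begin
      sum t ks
        ≤⟨ sum-⊆ {f = t} (0≤weightedTerm d) u ks⊆ ⟩
      sum t (applyUpTo id (2 ℕ.+ N))
        ≡⟨ sum-weightedTerm d (2 ℕ.+ N) ⟩
      cost
        ≤⟨ ≤-by (0≤g ⊗ (0≤g ⊗ p≤q⇒0≤q-p (horner-arithmetic {cast 2} {tail} (0≤cast 2) tail≡ N))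
              ⊕ 0≤W-1-gW ⊗ ((0≤1 ⊕ 0≤g ⊕ 0≤g ⊗ 0≤g) ⊗ 0≤W ⊕ (0≤cast 2 ⊕ 0≤cast 2 ⊗ 0≤g)))
            (trans (cong (λ e → (W ℚ.* W ℚ.- e) ℚ.- cost) gain-unfold) (cert g W (horner g tail N))) ⟩
      W ℚ.* W ℚ.- gain ∎
      where
      open ℚ.≤-Reasoning
      d = depth {natural} split
      t = weightedTerm (g ^ℚ_) d
      tail : ℕ → ℚ
      tail i = cast (d (suc (suc i)))
      tail≡ : ∀ i → tail i ≡ cast 2 ℚ.+ cast i
      tail≡ i = trans (cong cast (depth-split i)) (cast-+ 2 i)
      N = proj₁ (Chain.covered natural (↔-id ℕ) ks)
      cost = cast 2 ℚ.+ g ℚ.* (cast 2 ℚ.+ g ℚ.* horner g tail N)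
      ks⊆ : ks ⊆ applyUpTo id (2 ℕ.+ N)
      ks⊆ k∈ with i , i<N , refl ← ∈-applyUpTo⁻ id (proj₂ (Chain.covered natural (↔-id ℕ) ks) k∈) =
        ∈-applyUpTo⁺ id (ℕ.<-≤-trans i<N (ℕ.m≤n+m N 2))
      cert : ∀ g w x → (w ℚ.* w ℚ.- (g ℚ.+ g ℚ.* g ℚ.- 1ℚ) ℚ.* w) ℚ.- (cast 2 ℚ.+ g ℚ.* (cast 2 ℚ.+ g ℚ.* x)) ≡
        g ℚ.* (g ℚ.* ((cast 2 ℚ.* w ℚ.+ g ℚ.* (w ℚ.* w)) ℚ.- x)) ℚ.+
        (w ℚ.- (1ℚ ℚ.+ g ℚ.* w)) ℚ.* ((1ℚ ℚ.+ g ℚ.+ g ℚ.* g) ℚ.* w ℚ.+ (cast 2 ℚ.+ cast 2 ℚ.* g))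
      cert = solve-∀ ℚ-ring

    module _ (T : 2WCST natural) (k : ℕ) (root : 2WCST.tree T [] ≡ test ⟨= k ⟩) where
      open Removal T k root

      excess : ℕ → ℕ
      excess i = ℕ.pred (depth {natural} T i)

      term-excess : ∀ i → weightedTerm (g ^ℚ_) (depth {natural} T) i ≡ weightedTerm (g ^ℚ_) excess i ℚ.+ g ^ℚ i ℚ.* 1ℚ
      term-excess i = trans (cong (λ n → g ^ℚ i ℚ.* cast n) (depth-pred i))
        (trans (cong (g ^ℚ i ℚ.*_) (cast-suc (excess i))) (regroup (g ^ℚ i) (cast (excess i))))
        where
        regroup : ∀ x y → x ℚ.* (1ℚ ℚ.+ y) ≡ x ℚ.* y ℚ.+ x ℚ.* 1ℚ
        regroup = solve-∀ ℚ-ring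

      -- Closing the gap moves a key forward by at most one place, so its weight grows at most by
      -- the factor `1 / g`; the removed root takes one from its depth.
      removed-term : ∀ j → g ℚ.* weightedTerm (g ^ℚ_) (depth {natural} removed) j ℚ.≤ weightedTerm (g ^ℚ_) excess (skip k j)
      removed-term j = begin
        g ℚ.* (g ^ℚ j ℚ.* cast (depth {natural} removed j))
          ≡⟨ sym (ℚ.*-assoc g (g ^ℚ j) (cast (depth {natural} removed j))) ⟩
        (g ℚ.* g ^ℚ j) ℚ.* cast (depth {natural} removed j)
          ≤⟨ ℚ.*-monoʳ-≤-nonNeg (cast (depth {natural} removed j))
               {{ℚ.nonNegative (0≤cast (depth {natural} removed j))}} (g*gʲ≤g^skip k j) ⟩
        g ^ℚ skip k j ℚ.* cast (depth {natural} removed j)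
          ≡⟨ cong (λ n → g ^ℚ skip k j ℚ.* cast (ℕ.pred n)) (sym (depth-removed j)) ⟩
        g ^ℚ skip k j ℚ.* cast (excess (skip k j)) ∎
        where open ℚ.≤-Reasoning

      -- The root contributes the first `N` weights to the cost, that is `W - gᴺ W`; what remains is
      -- paid below it.
      excess-bound : ∀ {e} → Bounded T (W ℚ.* W ℚ.- e) → ∀ N →
        sum (weightedTerm (g ^ℚ_) excess) (applyUpTo id N) ℚ.≤ (W ℚ.* W ℚ.- e ℚ.- W) ℚ.+ g ^ℚ N ℚ.* W
      excess-bound {e} b N = ≤-by
        (p≤q⇒0≤q-p (subst (ℚ._≤ W ℚ.* W ℚ.- e) (sum-+ term-excess (applyUpTo id N))
          (b (applyUpTo id N) (Chain.applyUpTo-unique natural (↔-id ℕ) N))))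
        (trans (cong (λ w → ((W ℚ.* W ℚ.- e ℚ.- w) ℚ.+ y) ℚ.- x) W-sum) (cert (W ℚ.* W ℚ.- e) s x y))
        where
        x = sum (weightedTerm (g ^ℚ_) excess) (applyUpTo id N)
        s = sum (λ i → g ^ℚ i ℚ.* 1ℚ) (applyUpTo id N)
        y = g ^ℚ N ℚ.* W
        W-sum : W ≡ s ℚ.+ y
        W-sum = trans (W-partial N) (cong (ℚ._+ y) (sym (sum-pow N)))
        cert : ∀ c s x y → ((c ℚ.- (s ℚ.+ y)) ℚ.+ y) ℚ.- x ≡ c ℚ.- (x ℚ.+ s)
        cert = solve-∀ ℚ-ring

      g*removed≤ : ∀ {e} → Bounded T (W ℚ.* W ℚ.- e) → ∀ ks → Unique ks →
        g ℚ.* sum (weightedTerm (g ^ℚ_) (depth {natural} removed)) ks ℚ.≤ W ℚ.* W ℚ.- e ℚ.- W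
      g*removed≤ {e} b ks u = subst₂ ℚ._≤_ (cancel x c) (ℚ.+-identityˡ c)
        -- As `M` grows past all keys involved, the remainder `gᴹ W` vanishes.
        (ℚ.+-monoˡ-≤ c (≤gⁿ*c⇒≤0 {x ℚ.- c} {W} 0≤W (N , λ M N≤M → ≤-by (p≤q⇒0≤q-p (bound M N≤M)) (cert x c (g ^ℚ M ℚ.* W)))))
        where
        open ℚ.≤-Reasoning
        x = g ℚ.* sum (weightedTerm (g ^ℚ_) (depth {natural} removed)) ks
        c = W ℚ.* W ℚ.- e ℚ.- W
        N = proj₁ (Chain.covered natural (↔-id ℕ) (map (skip k) ks))
        inside : ∀ M → N ℕ.≤ M → map (skip k) ks ⊆ applyUpTo id M
        inside M N≤M i∈ with i , i<N , refl ← ∈-applyUpTo⁻ id (proj₂ (Chain.covered natural (↔-id ℕ) (map (skip k) ks)) i∈) =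
          ∈-applyUpTo⁺ id (ℕ.<-≤-trans i<N N≤M)
        cancel : ∀ x c → (x ℚ.- c) ℚ.+ c ≡ x
        cancel = solve-∀ ℚ-ring
        cert : ∀ x c y → y ℚ.- (x ℚ.- c) ≡ (c ℚ.+ y) ℚ.- x
        cert = solve-∀ ℚ-ring
        bound : ∀ M → N ℕ.≤ M → x ℚ.≤ c ℚ.+ g ^ℚ M ℚ.* W
        bound M N≤M = begin
          g ℚ.* sum (weightedTerm (g ^ℚ_) (depth {natural} removed)) ks
            ≡⟨ sym (sum-* g (weightedTerm (g ^ℚ_) (depth {natural} removed)) ks) ⟩
          sum (λ j → g ℚ.* weightedTerm (g ^ℚ_) (depth {natural} removed) j) ks
            ≤⟨ sum-mono removed-term ks ⟩
          sum (weightedTerm (g ^ℚ_) excess ∘ skip k) ks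
            ≡⟨ sym (sum-map (weightedTerm (g ^ℚ_) excess) (skip k) ks) ⟩
          sum (weightedTerm (g ^ℚ_) excess) (map (skip k) ks)
            ≤⟨ sum-⊆ {f = weightedTerm (g ^ℚ_) excess} (0≤weightedTerm excess) (Unique.map⁺ (skip-injective k) u) (inside M N≤M) ⟩
          sum (weightedTerm (g ^ℚ_) excess) (applyUpTo id M)
            ≤⟨ excess-bound {e} b M ⟩
          c ℚ.+ g ^ℚ M ℚ.* W ∎

      -- Since `W² - W = g W²`, dividing by `g` restores `W²` and enlarges the saving `e` by the
      -- factor `h`, the inverse of `g`.
      removed-bounded : ∀ {e} → Bounded T (W ℚ.* W ℚ.- e) → Bounded removed (W ℚ.* W ℚ.- e ℚ.* h)
      removed-bounded {e} b ks u = ℚ.*-cancelˡ-≤-pos g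
        (subst (g ℚ.* sum (weightedTerm (g ^ℚ_) (depth {natural} removed)) ks ℚ.≤_) (sym eq) (g*removed≤ {e} b ks u))
        where
        expand : ∀ g h w e → g ℚ.* (w ℚ.* w ℚ.- e ℚ.* h) ≡ (1ℚ ℚ.+ g ℚ.* w) ℚ.* w ℚ.- e ℚ.* (g ℚ.* h) ℚ.- w
        expand = solve-∀ ℚ-ring
        eq : g ℚ.* (W ℚ.* W ℚ.- e ℚ.* h) ≡ W ℚ.* W ℚ.- e ℚ.- W
        eq = trans (expand g h W e)
          (cong₂ (λ v y → v ℚ.* W ℚ.- y ℚ.- W) (sym W-unfold) (trans (cong (e ℚ.*_) g*h≡1) (ℚ.*-identityʳ e)))

      not-optimal : ¬ IsOptimal {natural} T
      not-optimal optimal = <⇒≱ 0<gain (≤gⁿ*c⇒≤0 {gain} {W ℚ.* W} (0≤W ⊗ 0≤W) (0 , λ n _ → gain≤ n))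
        where
        iterate : ∀ n → Bounded T (W ℚ.* W ℚ.- gain ℚ.* h ^ℚ n)
        iterate zero    = subst (Bounded T) (cong (λ e → W ℚ.* W ℚ.- e) (sym (ℚ.*-identityʳ gain)))
          (optimal⇒Bounded T optimal split {W ℚ.* W ℚ.- gain} split-bounded)
        iterate (suc n) = subst (Bounded T) (cong (λ e → W ℚ.* W ℚ.- e) (assoc gain h (h ^ℚ n)))
          -- Optimality returns the better bound of `removed` to `T` itself.
          (optimal⇒Bounded T optimal removed {W ℚ.* W ℚ.- gain ℚ.* h ^ℚ n ℚ.* h} (removed-bounded {gain ℚ.* h ^ℚ n} (iterate n)))
          where
          assoc : ∀ x y z → x ℚ.* z ℚ.* y ≡ x ℚ.* (y ℚ.* z)
          assoc = solve-∀ ℚ-ring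

        gⁿ*hⁿ≡1 : ∀ n → g ^ℚ n ℚ.* h ^ℚ n ≡ 1ℚ
        gⁿ*hⁿ≡1 zero    = refl
        gⁿ*hⁿ≡1 (suc n) = trans (regroup g (g ^ℚ n) h (h ^ℚ n)) (cong₂ ℚ._*_ g*h≡1 (gⁿ*hⁿ≡1 n))
          where
          regroup : ∀ a b c d → (a ℚ.* b) ℚ.* (c ℚ.* d) ≡ (a ℚ.* c) ℚ.* (b ℚ.* d)
          regroup = solve-∀ ℚ-ring

        gain≤ : ∀ n → gain ℚ.≤ g ^ℚ n ℚ.* (W ℚ.* W)
        -- On the empty list of keys, the bound says that `W² - gain hⁿ` is nonnegative; multiply
        -- this by `gⁿ`.
        gain≤ n = ≤-by (0≤gⁿ n ⊗ iterate n [] [])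
          (trans (cong (λ e → g ^ℚ n ℚ.* (W ℚ.* W) ℚ.- e) (trans (sym (ℚ.*-identityʳ gain)) (cong (gain ℚ.*_) (sym (gⁿ*hⁿ≡1 n)))))
            (cert (g ^ℚ n) (h ^ℚ n) (W ℚ.* W) gain))
          where
          cert : ∀ x y w e → x ℚ.* w ℚ.- e ℚ.* (x ℚ.* y) ≡ x ℚ.* (w ℚ.- e ℚ.* y)
          cert = solve-∀ ℚ-ring

-- Rational ratios just above the golden ratio

p≤∣p∣ : ∀ p → p ℚ.≤ ℚ.∣ p ∣
p≤∣p∣ p with ℚ.≤-total 0ℚ p
... | inj₁ 0≤p = ℚ.≤-reflexive (sym (ℚ.0≤p⇒∣p∣≡p 0≤p))
... | inj₂ p≤0 = ℚ.≤-trans p≤0 (ℚ.0≤∣p∣ p)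

Cauchy⇒≤ : ∀ {x} → Cauchy x → ∀ ε → 0ℚ ℚ.< ε →
  ∃[ N ] ∀ m n → N ℕ.≤ m → N ℕ.≤ n → x m ℚ.≤ x n ℚ.+ ε
Cauchy⇒≤ {x} cx ε 0<ε with N , f ← cx ε 0<ε = N , λ m n p q → ≤-by
  (p≤q⇒0≤q-p (ℚ.≤-trans (p≤∣p∣ (x m ℚ.- x n)) (ℚ.<⇒≤ (f m n p q)))) (cert (x m) (x n) ε)
  where
  cert : ∀ a b ε → (b ℚ.+ ε) ℚ.- a ≡ ε ℚ.- (a ℚ.- b)
  cert = solve-∀ ℚ-ring

1/8 1/16 : ℚ
1/8 = ½ ℚ.* ½ ℚ.* ½
1/16 = ½ ℚ.* ½ ℚ.* ½ ℚ.* ½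

-- Eight is the number of steps `η` spent in `upper-half`; the cap `1/16` keeps the ratio `above-γ₀`
-- within three quarters.
∃-eighth : ∀ ε → 0ℚ ℚ.< ε → ∃[ η ] 0ℚ ℚ.< η × cast 8 ℚ.* η ℚ.≤ ε × η ℚ.≤ 1/16
∃-eighth ε 0<ε with ℚ.≤-total ε ½
... | inj₁ ε≤½ = ε ℚ.* 1/8 , 0<p*q 0<ε 0<1/8 , ℚ.≤-reflexive (cert ε) , ≤-by (p≤q⇒0≤q-p ε≤½ ⊗ ℚ.<⇒≤ 0<1/8) (cert′ ε)
  where
  0<1/8 : 0ℚ ℚ.< 1/8
  0<1/8 = ℚ.positive⁻¹ 1/8
  cert : ∀ ε → cast 8 ℚ.* (ε ℚ.* 1/8) ≡ ε
  cert = solve-∀ ℚ-ring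
  cert′ : ∀ ε → 1/16 ℚ.- ε ℚ.* 1/8 ≡ (½ ℚ.- ε) ℚ.* 1/8
  cert′ = solve-∀ ℚ-ring
... | inj₂ ½≤ε = 1/16 , ℚ.positive⁻¹ 1/16 , ½≤ε , ℚ.≤-refl

0≤/ : ∀ a n → 0ℚ ℚ.≤ + a ℚ./ suc n
0≤/ a n = /-mono-≤ 0 0 a n z≤n

0≤√5 : ∀ n → 0ℚ ℚ.≤ √-seq 5 n
0≤√5 n = 0≤/ ⌊√ 5 ℕ.* (suc n ℕ.* suc n) ⌋ n

square-mono-< : ∀ {p q} → 0ℚ ℚ.< p → p ℚ.< q → p ℚ.* p ℚ.< q ℚ.* q
square-mono-< {p} {q} 0<p p<q =
  <-by (0<p*q (p<q⇒0<q-p p<q) (ℚ.+-mono-< (ℚ.<-trans 0<p p<q) 0<p)) (cert p q)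
  where
  cert : ∀ p q → q ℚ.* q ℚ.- p ℚ.* p ≡ (q ℚ.- p) ℚ.* (q ℚ.+ p)
  cert = solve-∀ ℚ-ring

9/4 : ℚ
9/4 = cast 9 ℚ.* (½ ℚ.* ½)

√5≤9/4 : ∀ n → √-seq 5 n ℚ.≤ 9/4
√5≤9/4 n = ℚ.≮⇒≥ λ 9/4<r →
  -- The square of `9/4` is `81/16`, just above `80/16 = 5`.
  <⇒≱ (ℚ.<-trans (/-mono-< 5 0 81 15 (ℕ.≤ᵇ⇒≤ 81 81 _)) (square-mono-< (ℚ.positive⁻¹ 9/4) 9/4<r)) (√5²≤5 n)

module AboveGolden (n : ℕ) (η : ℚ) (0<η : 0ℚ ℚ.< η) (η≤1/16 : η ℚ.≤ 1/16) (δ≤η : + 1 ℚ./ suc n ℚ.≤ η) where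

  private
    r = √-seq 5 n
    δ = + 1 ℚ./ suc n
    0≤η = ℚ.<⇒≤ 0<η
    0≤½ = ℚ.<⇒≤ 0<½

  -- The approximant `r` falls short of the root of 5 by less than `δ`, hence by less than `η`;
  -- adding `2η` to the approximant of `γ₀` overshoots the golden ratio.
  above-γ₀ : ℚ
  above-γ₀ = seq γ₀ n ℚ.+ (η ℚ.+ η)

  above-γ₀≤¾ : above-γ₀ ℚ.≤ ½ ℚ.+ ½ ℚ.* ½
  above-γ₀≤¾ = ≤-by (p≤q⇒0≤q-p (√5≤9/4 n) ⊗ 0≤½ ⊕ (p≤q⇒0≤q-p η≤1/16 ⊕ p≤q⇒0≤q-p η≤1/16)) (cert r η)
    where
    cert : ∀ r η → (½ ℚ.+ ½ ℚ.* ½) ℚ.- ((r ℚ.+ ℚ.- 1ℚ) ℚ.* ½ ℚ.+ (η ℚ.+ η)) ≡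
      (9/4 ℚ.- r) ℚ.* ½ ℚ.+ ((1/16 ℚ.- η) ℚ.+ (1/16 ℚ.- η))
    cert = solve-∀ ℚ-ring

  -- With `g` for `above-γ₀`, `2g + 1 = r + 4η` is at least `r + δ`, whose square exceeds 5.
  1<g+g² : 1ℚ ℚ.< above-γ₀ ℚ.+ above-γ₀ ℚ.* above-γ₀
  1<g+g² = <-by
    (0<p*q (0<p*q 0<½ 0<½) (ℚ.+-mono-<-≤ (p<q⇒0<q-p (5<√5⁺² n))
      ((p≤q⇒0≤q-p δ≤η ⊕ (0≤η ⊕ 0≤η ⊕ 0≤η)) ⊗ (0≤cast 2 ⊗ 0≤√5 n ⊕ δ+4η))))
    (cert r δ η)
    where
    δ+4η : 0ℚ ℚ.≤ δ ℚ.+ cast 4 ℚ.* η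
    δ+4η = 0≤/ 1 n ⊕ 0≤cast 4 ⊗ 0≤η
    cert : ∀ r δ η → (((r ℚ.+ ℚ.- 1ℚ) ℚ.* ½ ℚ.+ (η ℚ.+ η)) ℚ.+
      ((r ℚ.+ ℚ.- 1ℚ) ℚ.* ½ ℚ.+ (η ℚ.+ η)) ℚ.* ((r ℚ.+ ℚ.- 1ℚ) ℚ.* ½ ℚ.+ (η ℚ.+ η))) ℚ.- 1ℚ ≡
      (½ ℚ.* ½) ℚ.* (((r ℚ.+ δ) ℚ.* (r ℚ.+ δ) ℚ.- 5ℚ) ℚ.+
        ((η ℚ.- δ) ℚ.+ (η ℚ.+ η ℚ.+ η)) ℚ.* (cast 2 ℚ.* r ℚ.+ (δ ℚ.+ cast 4 ℚ.* η)))
    cert = solve-∀ ℚ-ring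

  0<above-γ₀ : 0ℚ ℚ.< above-γ₀
  0<above-γ₀ = ℚ.≰⇒> λ g≤0 → <⇒≱ 1<g+g² (≤-by
    ((p≤q⇒0≤q-p g≤0) ⊗ (0≤√5 n ⊗ 0≤½ ⊕ 0≤½ ⊕ (0≤η ⊕ 0≤η)) ⊕ 0≤1) (cert r η))
    where
    cert : ∀ r η → 1ℚ ℚ.- (((r ℚ.+ ℚ.- 1ℚ) ℚ.* ½ ℚ.+ (η ℚ.+ η)) ℚ.+
      ((r ℚ.+ ℚ.- 1ℚ) ℚ.* ½ ℚ.+ (η ℚ.+ η)) ℚ.* ((r ℚ.+ ℚ.- 1ℚ) ℚ.* ½ ℚ.+ (η ℚ.+ η))) ≡
      (0ℚ ℚ.- ((r ℚ.+ ℚ.- 1ℚ) ℚ.* ½ ℚ.+ (η ℚ.+ η))) ℚ.* (r ℚ.* ½ ℚ.+ ½ ℚ.+ (η ℚ.+ η)) ℚ.+ 1ℚ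
    cert = solve-∀ ℚ-ring

  ¬EqualToRootsBelow : ∀ {x} → fromℚ above-γ₀ < x → ¬ EqualToRootsBelow x
  ¬EqualToRootsBelow g<x h =
    let T , optimal , k , root = h (fromℚ above-γ₀) (IsGeometric.0<γ geometric) g<x
          (Ratio.natural above-γ₀ 0<above-γ₀ above-γ₀≤¾) geometric
    in Ratio.not-optimal above-γ₀ 0<above-γ₀ above-γ₀≤¾ 1<g+g² T k root optimal
    where
    geometric = Ratio.g-geometric above-γ₀ 0<above-γ₀ above-γ₀≤¾

-- At one late index `N`, `x` and `γ₀` are compared as rationals, which is decidable; the Cauchy
-- property extends the outcome to all later indices.
upper-half : ∀ x → EqualToRootsBelow x → x ≤ γ₀
upper-half x h ε 0<ε = go (∃-eighth ε 0<ε)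
  where
  go : ∃[ η ] 0ℚ ℚ.< η × cast 8 ℚ.* η ℚ.≤ ε × η ℚ.≤ 1/16 → Eventually λ n → seq x n ℚ.≤ seq γ₀ n ℚ.+ ε
  go (η , 0<η , 8η≤ε , η≤1/16) = decide (ℚ.≤-total (seq x N) (seq γ₀ N ℚ.+ cast 6 ℚ.* η))
    where
    X = Cauchy⇒≤ {seq x} (cauchy x) η 0<η
    G = Cauchy⇒≤ {seq γ₀} (cauchy γ₀) η 0<η
    D = 1/N≤ε η 0<η
    N = proj₁ X ℕ.⊔ (proj₁ G ℕ.⊔ proj₁ D)
    X≤N : proj₁ X ℕ.≤ N
    X≤N = ℕ.m≤m⊔n (proj₁ X) _
    G≤N : proj₁ G ℕ.≤ N
    G≤N = ℕ.≤-trans (ℕ.m≤m⊔n (proj₁ G) (proj₁ D)) (ℕ.m≤n⊔m (proj₁ X) _)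
    D≤N : proj₁ D ℕ.≤ N
    D≤N = ℕ.≤-trans (ℕ.m≤n⊔m (proj₁ G) (proj₁ D)) (ℕ.m≤n⊔m (proj₁ X) _)
    below : ∀ a b c d e η → (d ℚ.+ e) ℚ.- a ≡
      ((b ℚ.+ η) ℚ.- a) ℚ.+ ((c ℚ.+ cast 6 ℚ.* η) ℚ.- b) ℚ.+ ((d ℚ.+ η) ℚ.- c) ℚ.+ (e ℚ.- cast 8 ℚ.* η)
    below = solve-∀ ℚ-ring
    above : ∀ a b c η → b ℚ.- ((c ℚ.+ (η ℚ.+ η)) ℚ.+ η) ≡
      ((b ℚ.+ η) ℚ.- a) ℚ.+ (a ℚ.- (c ℚ.+ cast 6 ℚ.* η)) ℚ.+ (η ℚ.+ η)
    above = solve-∀ ℚ-ring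
    decide : seq x N ℚ.≤ seq γ₀ N ℚ.+ cast 6 ℚ.* η ⊎ seq γ₀ N ℚ.+ cast 6 ℚ.* η ℚ.≤ seq x N →
      Eventually λ n → seq x n ℚ.≤ seq γ₀ n ℚ.+ ε
    -- The total error is `η + 6η + η`, at most `ε`.
    decide (inj₁ x≤) = N , λ n N≤n → ≤-by
      (p≤q⇒0≤q-p (proj₂ X n N (ℕ.≤-trans X≤N N≤n) X≤N) ⊕ p≤q⇒0≤q-p x≤
        ⊕ p≤q⇒0≤q-p (proj₂ G N n G≤N (ℕ.≤-trans G≤N N≤n)) ⊕ p≤q⇒0≤q-p 8η≤ε)
      (below (seq x n) (seq x N) (seq γ₀ N) (seq γ₀ n) ε η)
    -- Of the gap `6η`, the ratio `above-γ₀` uses `2η` and the oscillation of `x` another `η`, so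
    -- `x` stays above that ratio by more than `η`.
    decide (inj₂ ≤x) = ⊥-elim (AboveGolden.¬EqualToRootsBelow N η 0<η η≤1/16 (proj₂ D N D≤N) {x}
      (η , 0<η , N , λ n N≤n → ≤-by
        (p≤q⇒0≤q-p (proj₂ X N n X≤N (ℕ.≤-trans X≤N N≤n)) ⊕ p≤q⇒0≤q-p ≤x ⊕ (ℚ.<⇒≤ 0<η ⊕ ℚ.<⇒≤ 0<η))
        (above (seq x N) (seq x n) (seq γ₀ N) η)) h)

theorem4p1 : IsGreatest EqualToRootsBelow ((√ 5 - 1ℝ) * ½ℝ)
theorem4p1 = lower-half , upper-half
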